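{- Let $R\geq 4$, let $q'$ be a prime power, $q=(q')^{R}$, and fix $\gamma\in\{2,3,\ldots,R-1\}$. Put $$n^{(\gamma)}_{R,q}=\frac{\sum_{i=1}^{\gamma+1}(\sqrt[R]{q}-1)^{i}\binom{R+\gamma}{i}}{\sqrt[R]{q}-1}\qquad\Bigl(\text{so } n^{(\gamma)}_{R,q}\sim\tbinom{R+\gamma}{R-1}q^{\gamma/R}\text{ as } q\to\infty\Bigr),$$ and let $t_0$ be an integer with $q^{t_0-1}\geq n^{(\gamma)}_{R,q}$. Then for every codimension $r=Rt+\gamma$ with $t=1$ or $t\geq t_0$ there exists a linear $[n,n-r]_q$ code with covering radius $R$ and length $$n=n^{(\gamma)}_{R,q}\cdot q^{\frac{r-(R+\gamma)}{R}}+w\,\frac{q^{\frac{r-(R+\gamma)}{R}}-1}{q-1}\quad\text{for some integer } 0\leq w\leq R-3.$$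
   Context: For a prime power $q$, an $[n,n-r]_q$ code is a linear subspace of $F_q^n$ of dimension $n-r$. It has covering radius $R$ if every column of $F_q^{r}$ is a linear combination of at most $R$ columns of a parity-check matrix of the code, and $R$ is the smallest integer with this property. -}

module Defs where

open import Level using (0ℓ)
open import Data.Nat using (ℕ; zero; suc; _∸_; _^_; _≤_; _/_)
import Data.Nat as N
open import Data.Nat.Primality using (Prime)
open import Data.Nat.Combinatorics using (_C_)
open import Data.Fin using (Fin)
import Data.Fin as Fin
open import Data.Product using (Σ; ∃; _×_)
open import Relation.Nullary using (¬_)
open import Relation.Binary.PropositionalEquality using (_≡_)
import Relation.Binary.PropositionalEquality as ≡
open import Algebra.Bundles using (CommutativeRing)
open import Function.Bundles using (Inverse)

IsPrimePower : ℕ → Set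
IsPrimePower q' = Σ ℕ λ p → Σ ℕ λ k → Prime p × (q' ≡ p ^ suc k)

record Field : Set₁ where
  field
    commutativeRing : CommutativeRing 0ℓ 0ℓ
  open CommutativeRing commutativeRing public
  field
    0≉1     : ¬ (0# ≈ 1#)
    inverse : ∀ x → ¬ (x ≈ 0#) → Σ Carrier λ y → (x * y) ≈ 1#

HasSize : Field → ℕ → Set
HasSize F q = Inverse (≡.setoid (Fin q)) setoid
  where open Field F

module _ (F : Field) where
  open Field F

  ∑ : (m : ℕ) → (Fin m → Carrier) → Carrier
  ∑ zero    x = 0#
  ∑ (suc m) x = x Fin.zero + ∑ m (λ j → x (Fin.suc j))

  -- A parity-check matrix H (r rows, n columns) over F.
  -- CoveredWithin H k : every column s ∈ F^r is a linear combination of at most k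
  -- columns of H.
  CoveredWithin : {r n : ℕ} → (Fin r → Fin n → Carrier) → ℕ → Set
  CoveredWithin {r} {n} H k =
    (s : Fin r → Carrier) →
    Σ ℕ λ m → (m ≤ k) ×
    Σ (Fin m → Fin n) λ idx → Σ (Fin m → Carrier) λ c →
      ∀ i → s i ≈ ∑ m (λ j → c j * H i (idx j))

  -- The code with parity-check matrix H has covering radius exactly R:
  -- R works, and R is the smallest integer that works.
  HasCoveringRadius : {r n : ℕ} → (Fin r → Fin n → Carrier) → ℕ → Set
  HasCoveringRadius H R = CoveredWithin H R × (∀ k → CoveredWithin H k → R ≤ k)

-- Natural-number division, used only where the divisor is known to be positive
-- (and the quotient is known to be exact); a div 0 is set to 0 (never used).
_div_ : ℕ → ℕ → ℕ
a div zero    = 0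
a div (suc b) = a / suc b

∑ℕ₁ : ℕ → (ℕ → ℕ) → ℕ
∑ℕ₁ zero    f = 0
∑ℕ₁ (suc N) f = ∑ℕ₁ N f N.+ f (suc N)

-- n^{(γ)}_{R,q} with q^{1/R} = q' :
--   ( ∑_{i=1}^{γ+1} (q' - 1)^i * binom(R+γ, i) ) / (q' - 1)
nGamma : (R q' γ : ℕ) → ℕ
nGamma R q' γ = (∑ℕ₁ (suc γ) (λ i → (q' ∸ 1) ^ i N.* ((R N.+ γ) C i))) div (q' ∸ 1)

-- Let K be the subfield of q' elements of F. The first n = R+γ rows of the matrix hold the points of PG(n-1, q') of
-- weight at most γ+1. If a ∈ Fⁿ has at least R nonzero entries, choose R of them whose positions P contain a K-basis of
-- the span of all entries; expressing the others over K gives a = Σ_{p∈P} a_p u_p, where each u_p ∈ Kⁿ is zero on P apart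
-- from p and hence of weight at most γ+1. If the basis is chosen greedily, the u_p have distinct last positions, so a
-- colouring with only 2n ≤ q colours suffices to separate the columns used. Vectors with fewer nonzero entries are sums
-- of at least 3 (and at most R) differently coloured columns as well.
--
-- For t = m+1 each column v is replaced by the columns (v, ξ, βξ, …, β^{R-1}ξ), ξ ∈ Fᵐ, where β ∈ F encodes the colour
-- of v. A representation of a by l ≥ 3 columns of distinct colours fits the first l blocks by a Vandermonde system, and
-- R-l columns from the R-3 simplex blocks repair the others.
--
-- Conversely, the entries in the first n rows of a combination of l columns lie in the K-span of l elements, so a vector
-- whose entries there span F over K is not covered by fewer than R columns.
module Submission where

open import Defs
open import Level using (0ℓ)
open import Algebra.Bundles using (CommutativeRing)
open import Algebra.Solver.Ring.AlmostCommutativeRing using (_-Raw-AlmostCommutative⟶_; fromCommutativeRing)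
open import Data.Nat using (ℕ; zero; suc; _∸_; _≤_; _<_; z≤n; s≤s)
import Data.Nat as ℕ
import Data.Nat.Properties as ℕ
open import Data.Nat.Combinatorics using (_C_; nC1≡n; nCn≡1; nCk+nC[k+1]≡[n+1]C[k+1]; k>n⇒nCk≡0)
open import Data.Nat.Divisibility using (_∣_; divides; ∣⇒≤)
open import Data.Nat.DivMod using (m*n/n≡m)
open import Data.Nat.Primality using (Prime; euclidsLemma; prime⇒nonTrivial)
open import Data.Nat.Tactic.RingSolver using () renaming (solve-∀ to ℕ-solve-∀)
open import Data.Integer as ℤ using (ℤ; -[1+_]; _⊖_)
import Data.Integer.Properties as ℤ
open import Data.Fin as Fin using (Fin; zero; suc; toℕ; fromℕ; fromℕ<; inject₁; inject≤; punchIn; splitAt; join; _↑ˡ_; _↑ʳ_; combine; remQuot; finToFun; funToFin)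
import Data.Fin.Properties as Fin
import Data.Fin.Permutation as Perm
open import Data.Vec as Vec using (Vec; []; _∷_)
import Data.Vec.Functional as Vector
open import Data.Maybe using (Maybe; map)
open import Data.Product using (Σ; _×_; _,_; proj₁; proj₂)
open import Data.Sum as Sum using (_⊎_; inj₁; inj₂; [_,_]′)
open import Data.Empty using (⊥)
open import Data.List as List using (List; []; _∷_; length; _++_; filter)
import Data.List.Properties as List
open import Data.List.Relation.Unary.All as All using (All; []; _∷_)
import Data.List.Relation.Unary.All.Properties as All
open import Data.List.Relation.Unary.Any as Any using (Any; here; there)
import Data.List.Relation.Unary.Any.Properties as Any
open import Data.List.Relation.Unary.AllPairs as AllPairs using (AllPairs; []; _∷_)
import Data.List.Relation.Unary.AllPairs.Properties as AllPairs
open import Data.List.Relation.Unary.Unique.Propositional using (Unique)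
import Data.List.Relation.Unary.Unique.Propositional.Properties as Unique
open import Data.List.Membership.Propositional using (_∈_; _∉_)
open import Data.List.Membership.Propositional.Properties using (∈-lookup; ∈-filter⁺; ∈-filter⁻; ∈-++⁺ˡ; ∈-++⁺ʳ; ∈-++⁻; ∈-map⁺; ∈-map⁻; ∈-allFin)
import Data.List.Membership.Setoid as SetoidMembership
import Data.List.Membership.Setoid.Properties as SetoidMembershipₚ
open import Function using (_∘_; id)
open import Function.Bundles using (Inverse)
open import Relation.Binary.Consequences using (dec⇒weaklyDec)
open import Relation.Binary.PropositionalEquality as ≡ using (_≡_; _≢_)
open import Relation.Nullary using (¬_; ¬?; yes; no; Dec)
open import Relation.Nullary.Decidable using (map′)
open import Relation.Nullary.Negation using (contradiction)
open import Relation.Unary using (Pred; Decidable)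

-- The field `F` is arbitrary and known only through a bijection with `Fin q`. So `K` has to be cut
-- out of it, as the fixed points of `x ↦ x ^ q′`, and every dimension argument over `K` is a
-- comparison of cardinalities: the `q′ ^ l` combinations of an independent list inject into the
-- `q′ ^ R` elements of `F`, and a spanning list gives an injection in the other direction. The
-- number three comes from `w ≤ R - 3`. At most `R - 3` of the lower blocks receive simplex columns,
-- so the Vandermonde system has to settle at least three blocks. Hence every top part, even the
-- zero vector, must be written with at least three differently coloured columns. A longer
-- representation costs nothing: each further column at the top settles one more block and saves the
-- simplex column for it, so the total never exceeds `R`.

-- Ring solver with integer coefficients

module IntegerCoefficients (R : CommutativeRing 0ℓ 0ℓ) where
  open import Data.Integer using (+_)
  open CommutativeRing R
  open import Algebra.Properties.Ring ring
  open import Algebra.Properties.Semiring.Mult.TCOptimised semiring renaming (_×_ to _·_)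
  import Algebra.Solver.Ring.NaturalCoefficients.Default commutativeSemiring as N
  open import Relation.Binary.Reasoning.Setoid setoid

  private
    ⟦_⟧ : ℤ → Carrier
    ⟦ + n ⟧      = n · 1#
    ⟦ -[1+ n ] ⟧ = - (suc n · 1#)

    suc-· : ∀ n → suc n · 1# ≈ 1# + n · 1#
    suc-· n = ×-homo-+ 1# 1 n

    ⊖-homo : ∀ m n → ⟦ m ⊖ n ⟧ ≈ m · 1# - n · 1#
    ⊖-homo m zero = sym (trans (+-congˡ -0#≈0#) (+-identityʳ _))
    ⊖-homo zero (suc n) = sym (+-identityˡ _)
    ⊖-homo (suc m) (suc n) = begin
      ⟦ suc m ⊖ suc n ⟧ ≡⟨ ≡.cong ⟦_⟧ (ℤ.[1+m]⊖[1+n]≡m⊖n m n) ⟩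
      ⟦ m ⊖ n ⟧ ≈⟨ ⊖-homo m n ⟩
      m · 1# - n · 1# ≈⟨ +-identityˡ _ ⟨
      0# + (m · 1# - n · 1#) ≈⟨ +-congʳ (-‿inverseʳ 1#) ⟨
      (1# - 1#) + (m · 1# - n · 1#)
        ≈⟨ N.solve 4 (λ a b c d → (a N.:+ b) N.:+ (c N.:+ d) N.:= (a N.:+ c) N.:+ (b N.:+ d)) refl _ _ _ _ ⟩
      (1# + m · 1#) + (- 1# - n · 1#) ≈⟨ +-cong (suc-· m) (trans (-‿cong (suc-· n)) (sym (-‿+-comm 1# (n · 1#)))) ⟨
      suc m · 1# - suc n · 1# ∎

    +-homo : ∀ i j → ⟦ i ℤ.+ j ⟧ ≈ ⟦ i ⟧ + ⟦ j ⟧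
    +-homo (+ m) (+ n) = ×-homo-+ 1# m n
    +-homo (+ m) -[1+ n ] = ⊖-homo m (suc n)
    +-homo -[1+ m ] (+ n) = trans (⊖-homo n (suc m)) (+-comm _ _)
    +-homo -[1+ m ] -[1+ n ] = begin
      - (suc (suc (m ℕ.+ n)) · 1#) ≡⟨ ≡.cong (λ k → - (suc k · 1#)) (ℕ.+-suc m n) ⟨
      - ((suc m ℕ.+ suc n) · 1#) ≈⟨ -‿cong (×-homo-+ 1# (suc m) (suc n)) ⟩
      - (suc m · 1# + suc n · 1#) ≈⟨ -‿+-comm _ _ ⟨
      - (suc m · 1#) - suc n · 1# ∎

    -homo : ∀ i → ⟦ ℤ.- i ⟧ ≈ - ⟦ i ⟧
    -homo (+ zero) = sym -0#≈0#
    -homo (+ suc n) = refl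
    -homo -[1+ n ] = sym (-‿involutive _)

    *-homo⁺ : ∀ m j → ⟦ + m ℤ.* j ⟧ ≈ m · 1# * ⟦ j ⟧
    *-homo⁺ m (+ n) = trans (reflexive (≡.cong ⟦_⟧ (≡.sym (ℤ.pos-* m n)))) (×1-homo-* m n)
    *-homo⁺ m -[1+ n ] = begin
      ⟦ + m ℤ.* ℤ.- (+ suc n) ⟧ ≡⟨ ≡.cong ⟦_⟧ (≡.sym (ℤ.neg-distribʳ-* (+ m) (+ suc n))) ⟩
      ⟦ ℤ.- (+ m ℤ.* + suc n) ⟧ ≈⟨ -homo (+ m ℤ.* + suc n) ⟩
      - ⟦ + m ℤ.* + suc n ⟧ ≈⟨ -‿cong (*-homo⁺ m (+ suc n)) ⟩
      - (m · 1# * (suc n · 1#)) ≈⟨ -‿distribʳ-* _ _ ⟩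
      m · 1# * - (suc n · 1#) ∎

    *-homo : ∀ i j → ⟦ i ℤ.* j ⟧ ≈ ⟦ i ⟧ * ⟦ j ⟧
    *-homo (+ m) j = *-homo⁺ m j
    *-homo -[1+ m ] j = begin
      ⟦ ℤ.- (+ suc m) ℤ.* j ⟧ ≡⟨ ≡.cong ⟦_⟧ (≡.sym (ℤ.neg-distribˡ-* (+ suc m) j)) ⟩
      ⟦ ℤ.- (+ suc m ℤ.* j) ⟧ ≈⟨ -homo (+ suc m ℤ.* j) ⟩
      - ⟦ + suc m ℤ.* j ⟧ ≈⟨ -‿cong (*-homo⁺ (suc m) j) ⟩
      - (suc m · 1# * ⟦ j ⟧) ≈⟨ -‿distribˡ-* _ _ ⟩
      - (suc m · 1#) * ⟦ j ⟧ ∎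

    -- Coefficients are taken from `ℤ` because its equality is decidable, while that of `R` need not
    -- be, and because it provides for subtraction.
    morphism : CommutativeRing.rawRing ℤ.+-*-commutativeRing -Raw-AlmostCommutative⟶ fromCommutativeRing R
    morphism = record
      { ⟦_⟧ = ⟦_⟧ ; +-homo = +-homo ; *-homo = *-homo ; -‿homo = -homo ; 0-homo = refl ; 1-homo = refl }

    _coeff≟_ : ∀ i j → Maybe (⟦ i ⟧ ≈ ⟦ j ⟧)
    i coeff≟ j = map (λ e → reflexive (≡.cong ⟦_⟧ e)) (dec⇒weaklyDec ℤ._≟_ i j)

  open import Algebra.Solver.Ring _ _ morphism _coeff≟_ public
    using (solve; _:=_; _:+_; _:*_; _:-_; :-_; con)

-- Binomial coefficients divisible by a prime

C-absorb : ∀ n k → suc k ℕ.* (suc n C suc k) ≡ suc n ℕ.* (n C k)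
C-absorb n zero = ≡.trans (ℕ.*-identityˡ _) (≡.trans (nC1≡n (suc n)) (≡.sym (ℕ.*-identityʳ _)))
C-absorb zero (suc k) = ≡.trans (≡.cong (suc (suc k) ℕ.*_) (k>n⇒nCk≡0 (s≤s (s≤s (z≤n {k})))))
  (≡.trans (ℕ.*-zeroʳ (suc (suc k))) (≡.cong (1 ℕ.*_) (≡.sym (k>n⇒nCk≡0 (s≤s (z≤n {k}))))))
C-absorb (suc n) (suc k) = begin
  suc (suc k) ℕ.* (suc (suc n) C suc (suc k))
    ≡⟨ ≡.cong (suc (suc k) ℕ.*_) (nCk+nC[k+1]≡[n+1]C[k+1] (suc n) (suc k)) ⟨
  suc (suc k) ℕ.* ((suc n C suc k) ℕ.+ (suc n C suc (suc k)))
    ≡⟨ ℕ.*-distribˡ-+ (suc (suc k)) (suc n C suc k) _ ⟩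
  ((suc n C suc k) ℕ.+ suc k ℕ.* (suc n C suc k)) ℕ.+ suc (suc k) ℕ.* (suc n C suc (suc k))
    ≡⟨ ≡.cong₂ (λ u v → ((suc n C suc k) ℕ.+ u) ℕ.+ v) (C-absorb n k) (C-absorb n (suc k)) ⟩
  ((suc n C suc k) ℕ.+ suc n ℕ.* (n C k)) ℕ.+ suc n ℕ.* (n C suc k)
    ≡⟨ ℕ.+-assoc (suc n C suc k) _ _ ⟩
  (suc n C suc k) ℕ.+ (suc n ℕ.* (n C k) ℕ.+ suc n ℕ.* (n C suc k))
    ≡⟨ ≡.cong ((suc n C suc k) ℕ.+_) (ℕ.*-distribˡ-+ (suc n) (n C k) (n C suc k)) ⟨
  (suc n C suc k) ℕ.+ suc n ℕ.* ((n C k) ℕ.+ (n C suc k))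
    ≡⟨ ≡.cong (λ u → (suc n C suc k) ℕ.+ suc n ℕ.* u) (nCk+nC[k+1]≡[n+1]C[k+1] n k) ⟩
  suc (suc n) ℕ.* (suc n C suc k) ∎
  where open ≡.≡-Reasoning

-- By absorption the prime divides `suc k` times the binomial coefficient, and `suc k` is too small
-- to be divisible by it.
p∣pCk : ∀ {n} → Prime (suc n) → ∀ k → k < n → suc n ∣ (suc n C suc k)
p∣pCk {n} pr k k<n with euclidsLemma (suc k) (suc n C suc k) pr
       (divides (n C k) (≡.trans (C-absorb n k) (ℕ.*-comm (suc n) (n C k))))
... | inj₁ d = contradiction (∣⇒≤ d) (ℕ.<⇒≱ (s≤s k<n))
... | inj₂ d = d

length-filter-¬ : ∀ {A : Set} {P : Pred A 0ℓ} (P? : Decidable P) xs →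
  length xs ≡ length (filter P? xs) ℕ.+ length (filter (λ x → ¬? (P? x)) xs)
length-filter-¬ P? [] = ≡.refl
length-filter-¬ P? (x ∷ xs) with P? x
... | yes _ = ≡.cong suc (length-filter-¬ P? xs)
... | no  _ = ≡.trans (≡.cong suc (length-filter-¬ P? xs)) (≡.sym (ℕ.+-suc _ _))

-- Monic polynomials and the Frobenius map over a field

module FieldProperties (F : Field) where
  open Field F public hiding (zero)
  open import Algebra.Properties.Ring ring public
  open import Algebra.Properties.CommutativeSemiring.Exp commutativeSemiring public
  open import Algebra.Properties.Semiring.Mult semiring public renaming (_×_ to _·_)
  open import Relation.Binary.Reasoning.Setoid setoid public
  module IC = IntegerCoefficients commutativeRing

  *-cancel : ∀ {x y z} → x ≉ 0# → x * y ≈ x * z → y ≈ z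
  *-cancel {x} {y} {z} x≉0 e with inverse x x≉0
  ... | x⁻¹ , xx⁻¹ = begin
    y ≈⟨ *-identityˡ y ⟨
    1# * y ≈⟨ *-congʳ xx⁻¹ ⟨
    (x * x⁻¹) * y ≈⟨ solve 3 (λ a b c → (a :* b) :* c := b :* (a :* c)) refl x x⁻¹ y ⟩
    x⁻¹ * (x * y) ≈⟨ *-congˡ e ⟩
    x⁻¹ * (x * z) ≈⟨ solve 3 (λ a b c → (a :* b) :* c := b :* (a :* c)) refl x x⁻¹ z ⟨
    (x * x⁻¹) * z ≈⟨ *-congʳ xx⁻¹ ⟩
    1# * z ≈⟨ *-identityˡ z ⟩
    z ∎
    where open IC

  *-zero-cancel : ∀ {x y} → x ≉ 0# → x * y ≈ 0# → y ≈ 0#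
  *-zero-cancel x≉0 e = *-cancel x≉0 (trans e (sym (zeroʳ _)))

  *-≉0 : ∀ {x y} → x ≉ 0# → y ≉ 0# → x * y ≉ 0#
  *-≉0 x≉0 y≉0 e = y≉0 (*-zero-cancel x≉0 e)

  1≉0 : 1# ≉ 0#
  1≉0 e = 0≉1 (sym e)

  x-y≈0⇒x≈y : ∀ {x y} → x - y ≈ 0# → x ≈ y
  x-y≈0⇒x≈y {x} {y} e = begin
    x           ≈⟨ solve 2 (λ a b → a := (a :- b) :+ b) refl x y ⟩
    (x - y) + y ≈⟨ +-congʳ e ⟩
    0# + y      ≈⟨ +-identityˡ y ⟩
    y           ∎
    where open IC

  x≈y⇒x-y≈0 : ∀ {x y} → x ≈ y → x - y ≈ 0#
  x≈y⇒x-y≈0 {x} {y} e = trans (+-congʳ e) (-‿inverseʳ y)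

  ^-≉0 : ∀ {x} → x ≉ 0# → ∀ n → x ^ n ≉ 0#
  ^-≉0 x≉0 zero = 1≉0
  ^-≉0 x≉0 (suc n) = *-≉0 x≉0 (^-≉0 x≉0 n)

  1^n≈1 : ∀ n → 1# ^ n ≈ 1#
  1^n≈1 zero = refl
  1^n≈1 (suc n) = trans (*-identityˡ _) (1^n≈1 n)

  -- The coefficients, lowest first, of a monic polynomial of degree d; the leading 1 is omitted.
  Monic : ℕ → Set
  Monic d = Vec Carrier d

  eval : ∀ {d} → Monic d → Carrier → Carrier
  eval [] x = 1#
  eval (c ∷ cs) x = x * eval cs x + c

  -- Synthetic division by `X - a`: the coefficients of the quotient are the Horner values at `a` of
  -- the tails of the polynomial.
  quotient : ∀ {d} → Carrier → Monic (suc d) → Monic d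
  quotient a (c ∷ []) = []
  quotient a (c ∷ cs@(_ ∷ _)) = eval cs a ∷ quotient a cs

  eval-quotient : ∀ {d} a (cs : Monic (suc d)) x →
    eval cs x ≈ (x - a) * eval (quotient a cs) x + eval cs a
  eval-quotient a (c ∷ []) x =
    solve 3 (λ a c x → x :* con (+ 1) :+ c := (x :- a) :* con (+ 1) :+ (a :* con (+ 1) :+ c)) refl a c x
    where open IC
          open import Data.Integer using (+_)
  eval-quotient a (c ∷ cs@(_ ∷ _)) x = begin
    x * eval cs x + c ≈⟨ +-congʳ (*-congˡ (eval-quotient a cs x)) ⟩
    x * ((x - a) * g + fa) + c
      ≈⟨ solve 5 (λ x a g f c → x :* ((x :- a) :* g :+ f) :+ c := (x :- a) :* (x :* g :+ f) :+ (a :* f :+ c)) refl x a g fa c ⟩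
    (x - a) * (x * g + fa) + (a * fa + c) ∎
    where
      open IC
      g = eval (quotient a cs) x
      fa = eval cs a

  -- Dividing by `X - a` for one root `a` leaves the other roots as roots of the quotient, since a
  -- field has no zero divisors. Monicity settles degree 0, where the polynomial is the constant 1.
  roots-bound : ∀ {d} (cs : Monic d) xs → AllPairs _≉_ xs → All (λ x → eval cs x ≈ 0#) xs → length xs ≤ d
  roots-bound cs [] _ _ = z≤n
  roots-bound [] (x ∷ xs) _ (e ∷ _) = contradiction e 1≉0
  roots-bound cs@(_ ∷ _) (a ∷ xs) (a≉ ∷ ps) (fa ∷ fs) =
    s≤s (roots-bound (quotient a cs) xs ps (All.zipWith root (a≉ , fs)))
    where
      root : ∀ {x} → (a ≉ x) × (eval cs x ≈ 0#) → eval (quotient a cs) x ≈ 0#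
      root {x} (a≉x , fx) = *-zero-cancel (λ e → a≉x (sym (x-y≈0⇒x≈y e))) (begin
        (x - a) * eval (quotient a cs) x ≈⟨ +-identityʳ _ ⟨
        (x - a) * eval (quotient a cs) x + 0# ≈⟨ +-congˡ fa ⟨
        (x - a) * eval (quotient a cs) x + eval cs a ≈⟨ eval-quotient a cs x ⟨
        eval cs x ≈⟨ fx ⟩
        0# ∎)

  eval-shift : ∀ k {d} (cs : Monic d) x → eval (Vec.replicate k 0# Vec.++ cs) x ≈ x ^ k * eval cs x
  eval-shift zero cs x = sym (*-identityˡ _)
  eval-shift (suc k) cs x = begin
    x * eval (Vec.replicate k 0# Vec.++ cs) x + 0# ≈⟨ +-identityʳ _ ⟩
    x * eval (Vec.replicate k 0# Vec.++ cs) x ≈⟨ *-congˡ (eval-shift k cs x) ⟩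
    x * (x ^ k * eval cs x) ≈⟨ *-assoc _ _ _ ⟨
    x * x ^ k * eval cs x ∎

  X^_∸1 : ∀ k → Monic (suc (k ℕ.+ 0))
  X^ k ∸1 = - 1# ∷ (Vec.replicate k 0# Vec.++ [])

  eval-X^∸1 : ∀ k x → eval (X^ k ∸1) x ≈ x ^ suc k - 1#
  eval-X^∸1 k x = +-congʳ (*-congˡ (trans (eval-shift k [] x) (*-identityʳ _)))

  -- 1 + Y + ⋯ + Y^e for Y = X^(1+k)
  geometric : ∀ k e → Monic (e ℕ.* suc k)
  geometric k zero = []
  geometric k (suc e) = 1# ∷ (Vec.replicate k 0# Vec.++ geometric k e)

  eval-geometric : ∀ k e x → (x ^ suc k - 1#) * eval (geometric k e) x ≈ (x ^ suc k) ^ suc e - 1#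
  eval-geometric k zero x = trans (*-identityʳ _) (+-congʳ (sym (*-identityʳ _)))
  eval-geometric k (suc e) x = begin
    (y - 1#) * (x * eval (Vec.replicate k 0# Vec.++ geometric k e) x + 1#)
      ≈⟨ *-congˡ (+-congʳ (trans (*-congˡ (eval-shift k (geometric k e) x)) (sym (*-assoc _ _ _)))) ⟩
    (y - 1#) * (y * g + 1#)
      ≈⟨ solve 2 (λ y g → (y :- con (+ 1)) :* (y :* g :+ con (+ 1)) := y :* ((y :- con (+ 1)) :* g) :+ (y :- con (+ 1))) refl y g ⟩
    y * ((y - 1#) * g) + (y - 1#) ≈⟨ +-congʳ (*-congˡ (eval-geometric k e x)) ⟩
    y * (y ^ suc e - 1#) + (y - 1#)
      ≈⟨ solve 2 (λ y z → y :* (z :- con (+ 1)) :+ (y :- con (+ 1)) := y :* z :- con (+ 1)) refl y (y ^ suc e) ⟩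
    y * y ^ suc e - 1# ∎
    where
      open IC
      open import Data.Integer using (+_)
      y = x ^ suc k
      g = eval (geometric k e) x

  module Frobenius {p : ℕ} (p-prime : Prime p) (p·1≈0 : p · 1# ≈ 0#) where
    open import Algebra.Properties.CommutativeSemiring.Binomial commutativeSemiring
    open import Algebra.Properties.CommutativeMonoid.Sum +-commutativeMonoid

    ∣⇒·≈0 : ∀ {c} z → p ∣ c → c · z ≈ 0#
    ∣⇒·≈0 z (divides m ≡.refl) = begin
      (m ℕ.* p) · z ≈⟨ ×-assocˡ z m p ⟨
      m · (p · z) ≈⟨ ×-congʳ m (×-congʳ p (*-identityʳ z)) ⟨
      m · (p · (z * 1#)) ≈⟨ ×-congʳ m (×-comm-* p z 1#) ⟨
      m · (z * (p · 1#)) ≈⟨ ×-congʳ m (trans (*-congˡ p·1≈0) (zeroʳ z)) ⟩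
      m · 0# ≈⟨ sum-replicate m ⟨
      sum {m} (λ _ → 0#) ≈⟨ sum-replicate-zero m ⟩
      0# ∎

    -- In the binomial expansion all terms except the first and the last have a coefficient
    -- divisible by `p`.
    frobenius-p : ∀ x y → (x + y) ^ p ≈ x ^ p + y ^ p
    frobenius-p x y = go p p-prime ∣⇒·≈0
      where
      -- The exponent is made a variable, with the annihilation of its multiples as a hypothesis, so
      -- that it can be matched as `suc n`.
      go : ∀ n → Prime n → (∀ {c} z → n ∣ c → c · z ≈ 0#) → (x + y) ^ n ≈ x ^ n + y ^ n
      go zero pr _ with prime⇒nonTrivial pr
      ... | ()
      go (suc n) pr kill = begin
        (x + y) ^ suc n ≈⟨ theorem (suc n) x y ⟩
        t zero + sum (λ k → t (suc k)) ≈⟨ +-congˡ (sum-init-last (λ k → t (suc k))) ⟩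
        t zero + (sum (λ k → t (suc (inject₁ k))) + t (suc (fromℕ n)))
          ≈⟨ +-cong low (+-cong (trans (sum-cong-≋ mid) (sum-replicate-zero n)) top) ⟩
        y ^ suc n + (0# + x ^ suc n) ≈⟨ trans (+-congˡ (+-identityˡ _)) (+-comm _ _) ⟩
        x ^ suc n + y ^ suc n ∎
        where
        t = binomialTerm x y (suc n)
        low : t zero ≈ y ^ suc n
        low = trans (×-homo-1 _) (*-identityˡ _)
        mid : ∀ (k : Fin n) → t (suc (inject₁ k)) ≈ 0#
        mid k = kill _ (p∣pCk pr (toℕ (inject₁ k)) (≡.subst (_< n) (≡.sym (Fin.toℕ-inject₁ k)) (Fin.toℕ<n k)))
        top : t (suc (fromℕ n)) ≈ x ^ suc n
        top rewrite Fin.toℕ-fromℕ n | nCn≡1 (suc n) | ℕ.n∸n≡0 n = trans (×-homo-1 _) (*-identityʳ _)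

    frobenius : ∀ j x y → (x + y) ^ (p ℕ.^ j) ≈ x ^ (p ℕ.^ j) + y ^ (p ℕ.^ j)
    frobenius zero x y = distribʳ 1# x y
    frobenius (suc j) x y = begin
      (x + y) ^ (p ℕ.* pʲ) ≈⟨ ^-assocʳ (x + y) p pʲ ⟨
      ((x + y) ^ p) ^ pʲ ≈⟨ ^-congˡ pʲ (frobenius-p x y) ⟩
      (x ^ p + y ^ p) ^ pʲ ≈⟨ frobenius j _ _ ⟩
      (x ^ p) ^ pʲ + (y ^ p) ^ pʲ ≈⟨ +-cong (^-assocʳ x p pʲ) (^-assocʳ y p pʲ) ⟩
      x ^ (p ℕ.* pʲ) + y ^ (p ℕ.* pʲ) ∎
      where pʲ = p ℕ.^ j

-- Finite fields: characteristic, Fermat's theorem, roots of unity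

module FiniteField (F : Field) {N : ℕ} (enum : HasSize F N) where
  open FieldProperties F public
  open Inverse enum public using (to; from; from-cong)

  to-from : ∀ x → to (from x) ≈ x
  to-from = Inverse.strictlyInverseˡ enum

  from-to : ∀ i → from (to i) ≡ i
  from-to = Inverse.strictlyInverseʳ enum

  from-injective : ∀ {x y} → from x ≡ from y → x ≈ y
  from-injective {x} {y} e = trans (sym (to-from x)) (trans (reflexive (≡.cong to e)) (to-from y))

  infix 4 _≟_
  _≟_ : ∀ x y → Dec (x ≈ y)
  x ≟ y = map′ from-injective from-cong (from x Fin.≟ from y)

  translate : Carrier → Perm.Permutation N N
  translate a = Perm.permutation (λ i → from (to i + a)) (λ i → from (to i - a))
    (λ i → ≡.trans (from-cong (trans (+-congʳ (to-from _)) (trans (+-assoc _ _ _) (trans (+-congˡ (-‿inverseˡ a)) (+-identityʳ _))))) (from-to i))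
    (λ i → ≡.trans (from-cong (trans (+-congʳ (to-from _)) (trans (+-assoc _ _ _) (trans (+-congˡ (-‿inverseʳ a)) (+-identityʳ _))))) (from-to i))

  scale : ∀ a → a ≉ 0# → Perm.Permutation N N
  scale a a≉0 = Perm.permutation (λ i → from (a * to i)) (λ i → from (b * to i))
    (λ i → ≡.trans (from-cong (cancel ab)) (from-to i))
    (λ i → ≡.trans (from-cong (cancel (trans (*-comm b a) ab))) (from-to i))
    where
    b = proj₁ (inverse a a≉0)
    ab = proj₂ (inverse a a≉0)
    cancel : ∀ {c d i} → c * d ≈ 1# → c * to (from (d * to i)) ≈ to i
    cancel cd = trans (*-congˡ (to-from _)) (trans (sym (*-assoc _ _ _)) (trans (*-congʳ cd) (*-identityˡ _)))

  -- Adding 1 permutes the field, so the sum of all elements does not change when `N · 1#` is added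
  -- to it.
  N·1≈0 : N · 1# ≈ 0#
  N·1≈0 = +-identityʳ-unique (sum to) (N · 1#) (begin
    sum to + N · 1# ≈⟨ +-congˡ (sum-replicate N) ⟨
    sum to + sum {N} (λ _ → 1#) ≈⟨ ∑-distrib-+ to (λ _ → 1#) ⟨
    sum {N} (λ i → to i + 1#) ≈⟨ sum-cong-≋ {N} (λ i → to-from (to i + 1#)) ⟨
    sum {N} (λ i → to (from (to i + 1#))) ≈⟨ sum-permute to (translate 1#) ⟨
    sum to ∎)
    where open import Algebra.Properties.CommutativeMonoid.Sum +-commutativeMonoid

  -- The `M`-th power of `p · 1#` is `N · 1#`, hence 0, and a field has no nilpotent elements except
  -- 0.
  char : ∀ p M → N ≡ p ℕ.^ M → p · 1# ≈ 0#
  char p M N≡ with p · 1# ≟ 0#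
  ... | yes e = e
  ... | no ne = contradiction (trans (sym (power M)) (trans (×-congˡ (≡.sym N≡)) N·1≈0)) (^-≉0 ne M)
    where
    power : ∀ M → (p ℕ.^ M) · 1# ≈ (p · 1#) ^ M
    power zero = ×-homo-1 1#
    power (suc M) = trans (×1-homo-* p (p ℕ.^ M)) (*-congˡ (power M))

  module _ {N′ : ℕ} (N≡ : N ≡ suc N′) where
   open import Algebra.Properties.CommutativeMonoid.Sum *-commutativeMonoid
     using () renaming (sum to prod; sum-permute to prod-permute; sum-cong-≋ to prod-cong;
       ∑-distrib-+ to prod-distrib; sum-remove to prod-remove; sum-replicate to prod-replicate)

   -- Multiplication by `a` permutes the field. The products run over the whole field: `nonzero`
   -- replaces 0 by 1, and `factor` is 1 at 0 and `a` at the `N′` other elements. So the product of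
   -- the nonzero elements equals itself times `a ^ N′`.
   fermat : ∀ a → a ≉ 0# → a ^ N′ ≈ 1#
   fermat a a≉0 = *-cancel (prod-≉0 {N} (λ i → nonzero-≉0 (to i))) (begin
    prod {N} f * a ^ N′ ≈⟨ *-congˡ prod-g ⟨
    prod {N} f * prod {N} g ≈⟨ prod-distrib {N} f g ⟨
    prod {N} (λ i → f i * g i) ≈⟨ prod-cong {N} (λ i → shift (to i)) ⟨
    prod {N} (λ i → nonzero (a * to i)) ≈⟨ prod-cong {N} (λ i → nonzero-cong (to-from (a * to i))) ⟨
    prod {N} (λ i → f (from (a * to i))) ≈⟨ prod-permute f (scale a a≉0) ⟨
    prod {N} f ≈⟨ *-identityʳ _ ⟨
    prod {N} f * 1# ∎)
    where
    nonzero : Carrier → Carrier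
    nonzero x with x ≟ 0#
    ... | yes _ = 1#
    ... | no  _ = x
    factor : Carrier → Carrier
    factor x with x ≟ 0#
    ... | yes _ = 1#
    ... | no  _ = a
    f g : Fin N → Carrier
    f i = nonzero (to i)
    g i = factor (to i)
    nonzero-≉0 : ∀ x → nonzero x ≉ 0#
    nonzero-≉0 x with x ≟ 0#
    ... | yes _ = 1≉0
    ... | no ne = ne
    nonzero-cong : ∀ {x y} → x ≈ y → nonzero x ≈ nonzero y
    nonzero-cong {x} {y} e with x ≟ 0# | y ≟ 0#
    ... | yes _ | yes _ = refl
    ... | yes u | no v = contradiction (trans (sym e) u) v
    ... | no u | yes v = contradiction (trans e v) u
    ... | no _ | no _ = e
    shift : ∀ x → nonzero (a * x) ≈ nonzero x * factor x
    shift x with x ≟ 0# | (a * x) ≟ 0#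
    ... | yes _ | yes _ = sym (*-identityˡ 1#)
    ... | yes u | no v = contradiction (trans (*-congˡ u) (zeroʳ a)) v
    ... | no u | yes v = contradiction v (*-≉0 a≉0 u)
    ... | no _ | no _ = *-comm a x
    factor-0 : ∀ {x} → x ≈ 0# → factor x ≈ 1#
    factor-0 {x} e with x ≟ 0#
    ... | yes _ = refl
    ... | no ne = contradiction e ne
    factor-≉0 : ∀ {x} → x ≉ 0# → factor x ≈ a
    factor-≉0 {x} ne with x ≟ 0#
    ... | yes e = contradiction e ne
    ... | no _ = refl
    prod-≉0 : ∀ {n} {h : Fin n → Carrier} → (∀ i → h i ≉ 0#) → prod h ≉ 0#
    prod-≉0 {zero} _ = 1≉0
    prod-≉0 {suc n} ne = *-≉0 (ne zero) (prod-≉0 (λ i → ne (suc i)))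
    remove-0 : ∀ {n} (h : Fin (suc n) → Carrier) i → h i ≈ 1# → (∀ j → ¬ (j ≡ i) → h j ≈ a) → prod h ≈ a ^ n
    remove-0 {n} h i e1 ea = begin
      prod h ≈⟨ prod-remove {i = i} h ⟩
      h i * prod (λ j → h (punchIn i j)) ≈⟨ *-cong e1 (prod-cong {n} (λ j → ea _ (Fin.punchInᵢ≢i i j))) ⟩
      1# * prod {n} (λ _ → a) ≈⟨ *-identityˡ _ ⟩
      prod {n} (λ _ → a) ≈⟨ prod-replicate n ⟩
      a ^ n ∎
    prod-g : prod {N} g ≈ a ^ N′
    prod-g = go N≡ g (from 0#) (factor-0 (to-from 0#))
      (λ j ne → factor-≉0 (λ e → ne (≡.trans (≡.sym (from-to j)) (from-cong e))))
      where
      go : ∀ {M} → M ≡ suc N′ → (h : Fin M → Carrier) (i : Fin M) → h i ≈ 1# → (∀ j → ¬ (j ≡ i) → h j ≈ a) → prod h ≈ a ^ N′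
      go ≡.refl = remove-0

  record Listing (P : Carrier → Set) (L : ℕ) : Set where
    field
      element : Fin L → Carrier
      element-P : ∀ i → P (element i)
      element-injective : ∀ {i j} → element i ≈ element j → i ≡ j
      element-surjective : ∀ {x} → P x → Σ (Fin L) λ i → element i ≈ x

  -- If N = 1 + Q(1+e) then X^N - X = X (X^Q - 1) (1 + X^Q + ⋯ + X^{Qe}) has N roots, so X^Q - 1 has Q roots.
  rootsOfUnity : ∀ k e → N ≡ suc (suc e ℕ.* suc k) → Listing (λ x → x ^ suc k ≈ 1#) (suc k)
  rootsOfUnity k e N≡ = ≡.subst (Listing _) (ℕ.≤-antisym upper lower) listing
    where
    open SetoidMembership setoid using () renaming (_∈_ to _∈′_)
    P? : ∀ x → Dec (x ^ suc k ≈ 1#)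
    P? x = x ^ suc k ≟ 1#
    Z? : ∀ x → Dec (x ≈ 0#)
    Z? x = x ≟ 0#
    els units others zeros rest : List Carrier
    els = List.tabulate to
    units = filter P? els
    others = filter (λ x → ¬? (P? x)) els
    zeros = filter Z? others
    rest = filter (λ x → ¬? (Z? x)) others
    els-distinct : AllPairs _≉_ els
    els-distinct = AllPairs.tabulate⁺ (λ {i} {j} ne e → ne (≡.trans (≡.sym (from-to i)) (≡.trans (from-cong e) (from-to j))))
    others-distinct : AllPairs _≉_ others
    others-distinct = AllPairs.filter⁺ (λ x → ¬? (P? x)) els-distinct
    upper : length units ≤ suc k
    upper = ≡.subst (length units ≤_) (≡.cong suc (ℕ.+-identityʳ k)) (roots-bound (X^ k ∸1) units (AllPairs.filter⁺ P? els-distinct)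
      (All.map (λ {x} e → trans (eval-X^∸1 k x) (x≈y⇒x-y≈0 e)) (All.all-filter P? els)))
    zeros-bound : length zeros ≤ 1
    zeros-bound = roots-bound (0# ∷ []) zeros (AllPairs.filter⁺ Z? others-distinct)
      (All.map (λ e → trans (+-identityʳ _) (trans (*-identityʳ _) e)) (All.all-filter Z? others))
    isRoot : ∀ {x} → (¬ (x ^ suc k ≈ 1#)) × (x ≉ 0#) → eval (geometric k e) x ≈ 0#
    isRoot {x} (ne1 , ne0) = *-zero-cancel (λ d → ne1 (x-y≈0⇒x≈y d)) (begin
      (x ^ suc k - 1#) * eval (geometric k e) x ≈⟨ eval-geometric k e x ⟩
      (x ^ suc k) ^ suc e - 1# ≈⟨ x≈y⇒x-y≈0 (trans (^-assocʳ x (suc k) (suc e))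
                                    (trans (^-congʳ x (ℕ.*-comm (suc k) (suc e))) (fermat N≡ x ne0))) ⟩
      0# ∎)
    rest-bound : length rest ≤ e ℕ.* suc k
    rest-bound = roots-bound (geometric k e) rest (AllPairs.filter⁺ (λ x → ¬? (Z? x)) others-distinct)
      (All.zipWith isRoot (All.filter⁺ (λ x → ¬? (Z? x)) (All.all-filter (λ x → ¬? (P? x)) els) , All.all-filter (λ x → ¬? (Z? x)) others))
    -- All `1 + Q + e Q` elements are split into `units`, `zeros` and `rest`. The last two have at
    -- most `1` and `e Q` members, which leaves at least `Q` for the first.
    lower : suc k ≤ length units
    lower = ℕ.+-cancelʳ-≤ (suc (e ℕ.* suc k)) (suc k) (length units) (≡.subst₂ _≤_
      (≡.sym (≡.trans (ℕ.+-suc (suc k) _) (≡.trans (≡.sym N≡) (≡.trans (≡.sym (List.length-tabulate to))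
        (≡.trans (length-filter-¬ P? els) (≡.cong (length units ℕ.+_) (length-filter-¬ Z? others))))))) ≡.refl
      (ℕ.+-monoʳ-≤ (length units) (ℕ.+-mono-≤ zeros-bound rest-bound)))
    complete : ∀ {x} → x ^ suc k ≈ 1# → x ∈′ units
    complete {x} px = SetoidMembershipₚ.∈-filter⁺ setoid P? (λ e p → trans (^-congˡ (suc k) (sym e)) p)
      (Any.tabulate⁺ {f = to} (from x) (sym (to-from x))) px
    lookup-injective : ∀ {xs} → AllPairs _≉_ xs → ∀ i j → List.lookup xs i ≈ List.lookup xs j → i ≡ j
    lookup-injective (_ ∷ _) zero zero e = ≡.refl
    lookup-injective (a ∷ _) zero (suc j) e = contradiction e (All.lookup a (∈-lookup j))
    lookup-injective (a ∷ _) (suc i) zero e = contradiction (sym e) (All.lookup a (∈-lookup i))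
    lookup-injective (_ ∷ d) (suc i) (suc j) e = ≡.cong suc (lookup-injective d i j e)
    listing : Listing (λ x → x ^ suc k ≈ 1#) (length units)
    listing = record
      { element = List.lookup units
      ; element-P = λ i → All.lookup (All.all-filter P? els) (∈-lookup i)
      ; element-injective = λ {i} {j} → lookup-injective (AllPairs.filter⁺ P? els-distinct) i j
      ; element-surjective = λ px → Any.index (complete px) , sym (Any.lookup-index (complete px)) }

-- The subfield `K` of `q′` elements and linear algebra over it

private
 power≡1+multiple : ∀ k R → Σ ℕ λ e → suc (suc k) ℕ.^ suc R ≡ suc (suc e ℕ.* suc k)
 power≡1+multiple k zero = 0 , lemma k
  where
  lemma : ∀ k → suc (suc k) ℕ.* 1 ≡ suc (1 ℕ.* suc k)
  lemma = ℕ-solve-∀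
 power≡1+multiple k (suc R) with power≡1+multiple k R
 -- With `Q = suc k` and `q′ = 1 + Q`: `q′ (1 + (1 + e) Q) = 1 + (1 + q′ (1 + e)) Q`.
 ... | e , eq = suc (suc k) ℕ.* suc e , ≡.trans (≡.cong (suc (suc k) ℕ.*_) eq) (lemma k e)
  where
  lemma : ∀ k e → suc (suc k) ℕ.* suc (suc e ℕ.* suc k) ≡ suc (suc (suc (suc k) ℕ.* suc e) ℕ.* suc k)
  lemma = ℕ-solve-∀

^-cancelʳ-≤ : ∀ k m n → suc (suc k) ℕ.^ m ≤ suc (suc k) ℕ.^ n → m ≤ n
^-cancelʳ-≤ k m n le with m ℕ.≤? n
... | yes m≤n = m≤n
... | no m≰n = contradiction le (ℕ.<⇒≱ (ℕ.^-monoʳ-< (suc (suc k)) (s≤s (s≤s z≤n)) (ℕ.≰⇒> m≰n)))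

module Subfield (F : Field) (p j k r : ℕ) (p-prime : Prime p) (q′≡p^j : suc (suc k) ≡ p ℕ.^ j)
                (enum : HasSize F (suc (suc k) ℕ.^ suc r)) where
  open FiniteField F enum public

  Q q′ R : ℕ
  Q = suc k
  q′ = suc Q
  R = suc r

  private
    q≡p^ : q′ ℕ.^ R ≡ p ℕ.^ (j ℕ.* R)
    q≡p^ = ≡.trans (≡.cong (ℕ._^ R) q′≡p^j) (ℕ.^-*-assoc p j R)

  -- The fixed points of an iterated Frobenius map. Closure under sums comes from additivity of that
  -- map, and the count of exactly `q′` elements from the roots of unity.
  K : Carrier → Set
  K x = x ^ q′ ≈ x

  K-resp : ∀ {x y} → x ≈ y → K x → K y
  K-resp e kx = trans (^-congˡ q′ (sym e)) (trans kx e)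

  K-0 : K 0#
  K-0 = zeroˡ _

  K-1 : K 1#
  K-1 = 1^n≈1 q′

  K-+ : ∀ {x y} → K x → K y → K (x + y)
  K-+ {x} {y} kx ky = begin
    (x + y) ^ q′ ≈⟨ ^-congʳ (x + y) q′≡p^j ⟩
    (x + y) ^ (p ℕ.^ j) ≈⟨ Frobenius.frobenius p-prime (char p (j ℕ.* R) q≡p^) j x y ⟩
    x ^ (p ℕ.^ j) + y ^ (p ℕ.^ j) ≈⟨ +-cong (^-congʳ x q′≡p^j) (^-congʳ y q′≡p^j) ⟨
    x ^ q′ + y ^ q′ ≈⟨ +-cong kx ky ⟩
    x + y ∎

  K-* : ∀ {x y} → K x → K y → K (x * y)
  K-* {x} {y} kx ky = trans (^-distrib-* x y q′) (*-cong kx ky)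

  K-inverse : ∀ {x y} → x * y ≈ 1# → K x → K y
  K-inverse {x} {y} xy≈1 kx = *-cancel x≉0 (begin
    x * y ^ q′ ≈⟨ *-congʳ kx ⟨
    x ^ q′ * y ^ q′ ≈⟨ ^-distrib-* x y q′ ⟨
    (x * y) ^ q′ ≈⟨ ^-congˡ q′ xy≈1 ⟩
    1# ^ q′ ≈⟨ 1^n≈1 q′ ⟩
    1# ≈⟨ xy≈1 ⟨
    x * y ∎)
    where
    x≉0 : x ≉ 0#
    x≉0 e = 1≉0 (trans (sym xy≈1) (trans (*-congʳ e) (zeroˡ y)))

  -- (-1)^q′ = -1 by additivity of x ↦ x^q′, whatever the parity of q′.
  K-neg : ∀ {x} → K x → K (- x)
  K-neg {x} kx = K-resp (-1*x≈-x x) (K-* k-1 kx)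
    where
    pow : ∀ n → 1# ^ (p ℕ.^ n) + (- 1#) ^ (p ℕ.^ n) ≈ (1# + - 1#) ^ (p ℕ.^ n)
    pow n = sym (Frobenius.frobenius p-prime (char p (j ℕ.* R) q≡p^) n 1# (- 1#))
    k-1 : K (- 1#)
    k-1 = +-cancelˡ 1# _ _ (begin
      1# + (- 1#) ^ q′ ≈⟨ +-cong (sym (1^n≈1 (p ℕ.^ j))) (^-congʳ (- 1#) q′≡p^j) ⟩
      1# ^ (p ℕ.^ j) + (- 1#) ^ (p ℕ.^ j) ≈⟨ pow j ⟩
      (1# + - 1#) ^ (p ℕ.^ j) ≈⟨ ^-congʳ _ q′≡p^j ⟨
      (1# + - 1#) ^ q′ ≈⟨ ^-congˡ q′ (-‿inverseʳ 1#) ⟩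
      0# ^ q′ ≈⟨ K-0 ⟩
      0# ≈⟨ -‿inverseʳ 1# ⟨
      1# + - 1# ∎)

  K-- : ∀ {x y} → K x → K y → K (x - y)
  K-- kx ky = K-+ kx (K-neg ky)

  private
    abstract
      units : Listing (λ x → x ^ Q ≈ 1#) Q
      units = let e , eq = power≡1+multiple k r in rootsOfUnity k e eq
    module Units = Listing units

  -- Zero comes first, so `suc` indexes exactly the nonzero elements; these indices are the labels
  -- of the nonzero coordinates in `Point`.
  κ : Fin q′ → Carrier
  κ zero = 0#
  κ (suc i) = Units.element i

  unit-≉0 : ∀ {x} → x ^ Q ≈ 1# → x ≉ 0#
  unit-≉0 e z = 1≉0 (trans (sym e) (trans (^-congˡ Q z) (zeroˡ _)))

  κ-K : ∀ i → K (κ i)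
  κ-K zero = K-0
  κ-K (suc i) = trans (*-congˡ (Units.element-P i)) (*-identityʳ _)

  κ-suc-≉0 : ∀ i → κ (suc i) ≉ 0#
  κ-suc-≉0 i = unit-≉0 (Units.element-P i)

  κ-injective : ∀ {i j} → κ i ≈ κ j → i ≡ j
  κ-injective {zero} {zero} e = ≡.refl
  κ-injective {zero} {suc j} e = contradiction (sym e) (κ-suc-≉0 j)
  κ-injective {suc i} {zero} e = contradiction e (κ-suc-≉0 i)
  κ-injective {suc i} {suc j} e = ≡.cong suc (Units.element-injective e)

  κ-surjective⁺ : ∀ {x} → K x → x ≉ 0# → Σ (Fin Q) λ i → κ (suc i) ≈ x
  κ-surjective⁺ kx x≉0 = Units.element-surjective (*-cancel x≉0 (trans kx (sym (*-identityʳ _))))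

  κ-surjective : ∀ {x} → K x → Σ (Fin q′) λ i → κ i ≈ x
  κ-surjective {x} kx with x ≟ 0#
  ... | yes x≈0 = zero , sym x≈0
  ... | no x≉0 = let i , e = κ-surjective⁺ kx x≉0 in suc i , e

  data Span : List Carrier → Carrier → Set where
    nil  : ∀ {y} → y ≈ 0# → Span [] y
    cons : ∀ {x xs y c z} → K c → Span xs z → y ≈ c * x + z → Span (x ∷ xs) y

  span-resp : ∀ {xs y z} → y ≈ z → Span xs y → Span xs z
  span-resp e (nil y≈0) = nil (trans (sym e) y≈0)
  span-resp e (cons kc s y≈) = cons kc s (trans (sym e) y≈)

  span-+ : ∀ {xs y z} → Span xs y → Span xs z → Span xs (y + z)
  span-+ (nil y≈0) (nil z≈0) = nil (trans (+-cong y≈0 z≈0) (+-identityˡ 0#))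
  span-+ (cons {x} {c = c} {y′} kc s y≈) (cons {c = d} {z′} kd t z≈) = cons (K-+ kc kd) (span-+ s t)
    (trans (+-cong y≈ z≈) (solve 5 (λ c x y d z → (c :* x :+ y) :+ (d :* x :+ z) := (c :+ d) :* x :+ (y :+ z)) refl c x y′ d z′))
    where open IC

  span-* : ∀ {xs y d} → K d → Span xs y → Span xs (d * y)
  span-* kd (nil y≈0) = nil (trans (*-congˡ y≈0) (zeroʳ _))
  span-* {d = d} kd (cons {x} {c = c} {z} kc s y≈) = cons (K-* kd kc) (span-* kd s)
    (trans (*-congˡ y≈) (solve 4 (λ d c x z → d :* (c :* x :+ z) := (d :* c) :* x :+ d :* z) refl d c x z))
    where open IC

  span-0 : ∀ xs → Span xs 0#
  span-0 [] = nil refl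
  span-0 (x ∷ xs) = cons K-0 (span-0 xs) (sym (trans (+-identityʳ _) (zeroˡ x)))

  span-trans : ∀ {xs ys y} → Span xs y → All (Span ys) xs → Span ys y
  span-trans {ys = ys} (nil y≈0) _ = span-resp (sym y≈0) (span-0 ys)
  span-trans (cons kc s y≈) (sx ∷ sxs) = span-resp (sym y≈) (span-+ (span-* kc sx) (span-trans s sxs))

  -- A coefficient vector is coded as one number below `q′ ^ length xs`. Membership in a span is
  -- then decided by finite search, and lengths are bounded by comparing finite sets.
  combination : (xs : List Carrier) → Fin (q′ ℕ.^ length xs) → Carrier
  combination [] i = 0#
  combination (x ∷ xs) i = let c , i′ = remQuot (q′ ℕ.^ length xs) i in κ c * x + combination xs i′

  combination-span : ∀ xs i → Span xs (combination xs i)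
  combination-span [] i = nil refl
  combination-span (x ∷ xs) i = let c , i′ = remQuot {q′} (q′ ℕ.^ length xs) i in cons (κ-K c) (combination-span xs i′) refl

  span-combination : ∀ {xs y} → Span xs y → Σ (Fin (q′ ℕ.^ length xs)) λ i → combination xs i ≈ y
  span-combination (nil y≈0) = zero , sym y≈0
  span-combination (cons {x} {xs} {y} {c} {z} kc s y≈) = combine c′ i′ , (begin
    combination (x ∷ xs) (combine c′ i′)
      ≡⟨ ≡.cong (λ u → κ (proj₁ u) * x + combination xs (proj₂ u)) (Fin.remQuot-combine c′ i′) ⟩
    κ c′ * x + combination xs i′ ≈⟨ +-cong (*-congʳ (proj₂ (κ-surjective kc))) (proj₂ (span-combination s)) ⟩
    c * x + z ≈⟨ y≈ ⟨
    y ∎)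
    where
    c′ = proj₁ (κ-surjective kc)
    i′ = proj₁ (span-combination s)

  span? : ∀ xs y → Dec (Span xs y)
  span? xs y = map′ (λ (i , e) → span-resp e (combination-span xs i)) span-combination
    (Fin.any? (λ i → combination xs i ≟ y))

  Independent : List Carrier → Set
  Independent xs = ∀ {i j} → combination xs i ≈ combination xs j → i ≡ j

  independent-length : ∀ {xs} → Independent xs → length xs ≤ R
  independent-length {xs} ind = ^-cancelʳ-≤ k (length xs) R (Fin.injective⇒≤ {f = λ i → from (combination xs i)}
    (λ e → ind (from-injective e)))

  -- Choosing a coefficient vector for each of the `q′ ^ R` elements is injective, as the vector
  -- determines the element.
  spanning-length : ∀ {xs} → (∀ y → Span xs y) → R ≤ length xs
  spanning-length {xs} sp = ^-cancelʳ-≤ k R (length xs) (Fin.injective⇒≤ {f = λ i → proj₁ (span-combination (sp (to i)))}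
    λ {i} {j} e → ≡.trans (≡.sym (from-to i)) (≡.trans (from-cong (trans (sym (proj₂ (span-combination (sp (to i)))))
      (trans (reflexive (≡.cong (combination xs) e)) (proj₂ (span-combination (sp (to j))))))) (from-to j)))

  independent-[] : Independent []
  independent-[] {zero} {zero} _ = ≡.refl

  -- If two equal combinations had different coefficients at `x`, dividing by the difference would
  -- put `x` into the span of `xs`.
  independent-∷ : ∀ {x xs} → Independent xs → ¬ Span xs x → Independent (x ∷ xs)
  independent-∷ {x} {xs} ind ¬span {i} {i₂} e = ≡.trans (≡.sym (Fin.combine-remQuot {q′} M i))
    (≡.trans (≡.cong₂ combine c≡ (ind tail≈)) (Fin.combine-remQuot {q′} M i₂))
    where
    M = q′ ℕ.^ length xs
    c = proj₁ (remQuot {q′} M i)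
    d = proj₁ (remQuot {q′} M i₂)
    u = combination xs (proj₂ (remQuot {q′} M i))
    v = combination xs (proj₂ (remQuot {q′} M i₂))
    difference : (κ c - κ d) * x ≈ v - u
    difference = begin
      (κ c - κ d) * x ≈⟨ solve 4 (λ c d x u → (c :- d) :* x := (c :* x :+ u) :- (d :* x :+ u)) refl (κ c) (κ d) x u ⟩
      (κ c * x + u) - (κ d * x + u) ≈⟨ +-congʳ e ⟩
      (κ d * x + v) - (κ d * x + u) ≈⟨ solve 4 (λ d x u v → (d :* x :+ v) :- (d :* x :+ u) := v :- u) refl (κ d) x u v ⟩
      v - u ∎
      where open IC
    c≡ : c ≡ d
    c≡ with κ c - κ d ≟ 0#
    ... | yes e₀ = κ-injective (x-y≈0⇒x≈y e₀)
    ... | no ne with inverse _ ne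
    ... | w , e₁ = contradiction (span-resp (begin
      w * (v + - 1# * u) ≈⟨ *-congˡ (+-congˡ (-1*x≈-x u)) ⟩
      w * (v - u) ≈⟨ *-congˡ difference ⟨
      w * ((κ c - κ d) * x) ≈⟨ *-assoc _ _ _ ⟨
      w * (κ c - κ d) * x ≈⟨ *-congʳ (trans (*-comm _ _) e₁) ⟩
      1# * x ≈⟨ *-identityˡ x ⟩
      x ∎)
      (span-* (K-inverse e₁ (K-- (κ-K c) (κ-K d)))
        (span-+ (combination-span xs _) (span-* (K-neg K-1) (combination-span xs _))))) ¬span
    tail≈ : u ≈ v
    tail≈ = +-cancelˡ (κ c * x) u v (trans e (+-congʳ (*-congʳ (reflexive (≡.cong κ (≡.sym c≡))))))

-- Lists of distinct positions and sums over lists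

lookup-injective : ∀ {A : Set} {xs : List A} → Unique xs → ∀ i j → List.lookup xs i ≡ List.lookup xs j → i ≡ j
lookup-injective (_ ∷ _) zero zero e = ≡.refl
lookup-injective (a ∷ _) zero (suc j) e = contradiction e (All.lookup a (∈-lookup j))
lookup-injective (a ∷ _) (suc i) zero e = contradiction (≡.sym e) (All.lookup a (∈-lookup i))
lookup-injective (_ ∷ d) (suc i) (suc j) e = ≡.cong suc (lookup-injective d i j e)

unique-⊆-length : ∀ {A : Set} {xs ys : List A} → Unique xs → (∀ {x} → x ∈ xs → x ∈ ys) → length xs ≤ length ys
unique-⊆-length {xs = xs} {ys} u sub = Fin.injective⇒≤ {f = λ i → Any.index (sub (∈-lookup {xs = xs} i))}
  λ {i} {j} e → lookup-injective u i j (≡.trans (Any.lookup-index (sub (∈-lookup i)))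
    (≡.trans (≡.cong (List.lookup ys) e) (≡.sym (Any.lookup-index (sub (∈-lookup j))))))

unique-length : ∀ {n} {xs : List (Fin n)} → Unique xs → length xs ≤ n
unique-length {n} {xs} u = ≡.subst (length xs ≤_) (List.length-tabulate {n = n} (λ i → i)) (unique-⊆-length u (λ {x} _ → ∈-allFin x))

module _ {n : ℕ} where
  open import Data.List.Membership.DecPropositional (Fin._≟_ {n}) public using (_∈?_)

-- `E` is taken from the members of `L` outside `I`. There are enough of them, because `L` is
-- contained in `I ++ fresh` and has no repetitions.
extend : ∀ {n} (I L : List (Fin n)) m → Unique I → Unique L → length I ≤ m → m ≤ length L →
  Σ (List (Fin n)) λ E → Unique (I ++ E) × (length (I ++ E) ≡ m) × (∀ {x} → x ∈ E → x ∈ L)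
extend I L m uI uL I≤m m≤L = E , Unique.++⁺ uI (Unique.take⁺ d (Unique.filter⁺ (λ x → ¬? (x ∈? I)) uL)) disjoint , len ,
  λ x∈ → proj₁ (new x∈)
  where
  d = m ∸ length I
  fresh = filter (λ x → ¬? (x ∈? I)) L
  E = List.take d fresh
  new : ∀ {x} → x ∈ E → x ∈ L × x ∉ I
  new x∈ = ∈-filter⁻ (λ x → ¬? (x ∈? I)) (All.lookup (All.take⁺ d (All.tabulate (λ z → z))) x∈)
  disjoint : ∀ {x} → (x ∈ I × x ∈ E) → ⊥
  disjoint (x∈I , x∈E) = proj₂ (new x∈E) x∈I
  cover : ∀ {x} → x ∈ L → x ∈ I ++ fresh
  cover {x} x∈L with x ∈? I
  ... | yes x∈I = ∈-++⁺ˡ x∈I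
  ... | no x∉I = ∈-++⁺ʳ I (∈-filter⁺ (λ x → ¬? (x ∈? I)) x∈L x∉I)
  d≤ : d ≤ length fresh
  d≤ = ℕ.m≤n+o⇒m∸n≤o m (length I) (ℕ.≤-trans m≤L (≡.subst (length L ≤_) (List.length-++ I) (unique-⊆-length uL cover)))
  len : length (I ++ E) ≡ m
  len = ≡.trans (List.length-++ I) (≡.trans (≡.cong (length I ℕ.+_) (≡.trans (List.length-take d fresh) (ℕ.m≤n⇒m⊓n≡m d≤)))
    (ℕ.m+[n∸m]≡n I≤m))

module ListSums (F : Field) where
  open FieldProperties F

  sumL : ∀ {A : Set} → (A → Carrier) → List A → Carrier
  sumL f [] = 0#
  sumL f (x ∷ xs) = f x + sumL f xs

  module _ {A : Set} {f g : A → Carrier} where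
    sumL-cong : ∀ xs → (∀ {x} → x ∈ xs → f x ≈ g x) → sumL f xs ≈ sumL g xs
    sumL-cong [] e = refl
    sumL-cong (x ∷ xs) e = +-cong (e (here ≡.refl)) (sumL-cong xs (e ∘ there))

  module _ {A : Set} {f : A → Carrier} where
    sumL-0 : ∀ xs → (∀ {x} → x ∈ xs → f x ≈ 0#) → sumL f xs ≈ 0#
    sumL-0 [] e = refl
    sumL-0 (x ∷ xs) e = trans (+-cong (e (here ≡.refl)) (sumL-0 xs (e ∘ there))) (+-identityˡ 0#)

    sumL-++ : ∀ xs ys → sumL f (xs ++ ys) ≈ sumL f xs + sumL f ys
    sumL-++ [] ys = sym (+-identityˡ _)
    sumL-++ (x ∷ xs) ys = trans (+-congˡ (sumL-++ xs ys)) (sym (+-assoc _ _ _))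

    sumL-map : ∀ {B : Set} (h : B → A) xs → sumL f (List.map h xs) ≡ sumL (f ∘ h) xs
    sumL-map h [] = ≡.refl
    sumL-map h (x ∷ xs) = ≡.cong (f (h x) +_) (sumL-map h xs)

    sumL-single : ∀ {x xs} → Unique xs → x ∈ xs → (∀ {y} → y ≢ x → f y ≈ 0#) → sumL f xs ≈ f x
    sumL-single (x∉ ∷ u) (here ≡.refl) z =
      trans (+-congˡ (sumL-0 _ (λ y∈ → z (λ e → All.lookup x∉ y∈ (≡.sym e))))) (+-identityʳ _)
    sumL-single (y∉ ∷ u) (there x∈) z =
      trans (+-cong (z (All.lookup y∉ x∈)) (sumL-single u x∈ z)) (+-identityˡ _)

-- Greedy bases and triangular expansions

module Greedy (F : Field) (p j k r : ℕ) (p-prime : Prime p) (q′≡p^j : suc (suc k) ≡ p ℕ.^ j)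
              (enum : HasSize F (suc (suc k) ℕ.^ suc r)) where
  open Subfield F p j k r p-prime q′≡p^j enum public
  open ListSums F public

  module _ {n : ℕ} (a : Fin n → Carrier) where
    -- Coefficients exist at all positions and vanish off `I`, so they can still be read off when
    -- `I` is enlarged to `R` positions.
    record Expansion (I : List (Fin n)) (y : Carrier) : Set where
      field
        coef : Fin n → Carrier
        coef-K : ∀ p → K (coef p)
        coef-support : ∀ p → p ∉ I → coef p ≈ 0#
        expand : y ≈ sumL (λ p → coef p * a p) I

    expansion : ∀ I {y} → Unique I → Span (List.map a I) y → Expansion I y
    expansion [] _ (nil y≈0) = record { coef = λ _ → 0# ; coef-K = λ _ → K-0 ; coef-support = λ _ _ → refl ; expand = y≈0 }
    expansion (p ∷ I) {y} (p∉ ∷ u) (cons {c = c} {z} kc s y≈) = record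
      { coef = coef′ ; coef-K = coef′-K ; coef-support = coef′-support
      ; expand = trans y≈ (+-cong (*-congʳ (sym coef′-p)) (trans E.expand (sumL-cong I λ q∈ → *-congʳ (sym (coef′-≢ (λ e → All.lookup p∉ q∈ (≡.sym e))))))) }
      where
      module E = Expansion (expansion I u s)
      coef′ : Fin n → Carrier
      coef′ q with q Fin.≟ p
      ... | yes _ = c
      ... | no _ = E.coef q
      coef′-K : ∀ q → K (coef′ q)
      coef′-K q with q Fin.≟ p
      ... | yes _ = kc
      ... | no _ = E.coef-K q
      coef′-support : ∀ q → q ∉ p ∷ I → coef′ q ≈ 0#
      coef′-support q q∉ with q Fin.≟ p
      ... | yes e = contradiction (here e) q∉
      ... | no _ = E.coef-support q (q∉ ∘ there)
      coef′-p : coef′ p ≈ c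
      coef′-p with p Fin.≟ p
      ... | yes _ = refl
      ... | no ne = contradiction ≡.refl ne
      coef′-≢ : ∀ {q} → q ≢ p → coef′ q ≈ E.coef q
      coef′-≢ {q} ne with q Fin.≟ p
      ... | yes e = contradiction e ne
      ... | no _ = refl

    expansion-span : ∀ I {c : Fin n → Carrier} → (∀ p → K (c p)) → Span (List.map a I) (sumL (λ p → c p * a p) I)
    expansion-span [] kc = nil refl
    expansion-span (p ∷ I) kc = cons (kc p) (expansion-span I kc) refl

    -- Choosing greedily from the right makes the expansions triangular, so the basis rows get distinct last positions.
    record Basis : Set where
      field
        I : List (Fin n)
        unique : Unique I
        independent : Independent (List.map a I)
        nonzero : ∀ {p} → p ∈ I → a p ≉ 0#
        expansions : ∀ j → Expansion I (a j)
        triangular : ∀ j p → p Fin.< j → Expansion.coef (expansions j) p ≈ 0#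

      span : ∀ j → Span (List.map a I) (a j)
      span j = span-resp (sym (Expansion.expand (expansions j))) (expansion-span I (Expansion.coef-K (expansions j)))

      length≤R : length I ≤ R
      length≤R = ≡.subst (_≤ R) (List.length-map a I) (independent-length {List.map a I} independent)

  map-suc-≢0 : ∀ {n} {I : List (Fin n)} → Fin.zero {n} ∉ List.map Fin.suc I
  map-suc-≢0 0∈ with ∈-map⁻ Fin.suc 0∈
  ... | _ , _ , ()

  lift-expansion : ∀ {n} {a : Fin (suc n) → Carrier} {I y} → Expansion (a ∘ suc) I y →
    ∀ {c₀} → c₀ ≈ 0# → Expansion a (List.map suc I) y
  lift-expansion {n} {a} {I} E {c₀} c₀≈0 = record { coef = coef′ ; coef-K = coef′-K ; coef-support = coef′-support
    ; expand = trans E.expand (reflexive (≡.sym (sumL-map suc I))) }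
    where
    module E = Expansion E
    coef′ : Fin (suc n) → Carrier
    coef′ zero = c₀
    coef′ (suc p) = E.coef p
    coef′-K : ∀ p → K (coef′ p)
    coef′-K zero = K-resp (sym c₀≈0) K-0
    coef′-K (suc p) = E.coef-K p
    coef′-support : ∀ p → p ∉ List.map suc I → coef′ p ≈ 0#
    coef′-support zero _ = c₀≈0
    coef′-support (suc p) p∉ = E.coef-support p (p∉ ∘ ∈-map⁺ suc)

  weaken-expansion : ∀ {n} {a : Fin n → Carrier} {I y p} → (E : Expansion a I y) → p ∉ I → Expansion a (p ∷ I) y
  weaken-expansion {p = p} E p∉ = record { coef = coef ; coef-K = coef-K ; coef-support = λ q q∉ → coef-support q (q∉ ∘ there)
    ; expand = trans expand (sym (trans (+-congʳ (trans (*-congʳ (coef-support p p∉)) (zeroˡ _))) (+-identityˡ _))) }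
    where open Expansion E

  self-expansion : ∀ {n} (a : Fin (suc n) → Carrier) I → Expansion a (zero ∷ List.map suc I) (a zero)
  self-expansion {n} a I = record { coef = δ ; coef-K = δ-K ; coef-support = δ-support
    ; expand = sym (trans (+-cong (*-identityˡ _) (trans (reflexive (sumL-map suc I)) (sumL-0 I λ _ → zeroˡ _))) (+-identityʳ _)) }
    where
    δ : Fin (suc n) → Carrier
    δ zero = 1#
    δ (suc _) = 0#
    δ-K : ∀ p → K (δ p)
    δ-K zero = K-1
    δ-K (suc _) = K-0
    δ-support : ∀ p → p ∉ zero ∷ List.map suc I → δ p ≈ 0#
    δ-support zero 0∉ = contradiction (here ≡.refl) 0∉
    δ-support (suc _) _ = refl

  -- The tail is treated first, and `a zero` joins only if it lies outside the span of the tail.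
  -- Hence the expansion of a later entry never involves position `zero`, which is triangularity.
  basis : ∀ {n} (a : Fin n → Carrier) → Basis a
  basis {zero} a = record { I = [] ; unique = [] ; independent = independent-[] ; nonzero = λ () ; expansions = λ () ; triangular = λ () }
  basis {suc n} a with basis (a ∘ suc)
  ... | B with span? (List.map (a ∘ suc) (Basis.I B)) (a zero)
  ... | yes s = record
    { I = List.map suc B.I ; unique = Unique.map⁺ Fin.suc-injective B.unique
    ; independent = ≡.subst Independent (List.map-∘ B.I) B.independent
    ; nonzero = nonzero ; expansions = expansions ; triangular = triangular }
    where
    module B = Basis B
    nonzero : ∀ {p} → p ∈ List.map suc B.I → a p ≉ 0#
    nonzero p∈ with ∈-map⁻ suc p∈
    ... | _ , p′∈ , ≡.refl = B.nonzero p′∈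
    expansions : ∀ j → Expansion a (List.map suc B.I) (a j)
    expansions zero = lift-expansion (expansion (a ∘ suc) B.I B.unique s) refl
    expansions (suc j) = lift-expansion (B.expansions j) refl
    triangular : ∀ j p → p Fin.< j → Expansion.coef (expansions j) p ≈ 0#
    triangular (suc j) zero _ = refl
    triangular (suc j) (suc p) (s≤s lt) = B.triangular j p lt
  ... | no ¬s = record
    { I = zero ∷ List.map suc B.I
    ; unique = All.tabulate (λ { 0∈ ≡.refl → map-suc-≢0 0∈ }) ∷ Unique.map⁺ Fin.suc-injective B.unique
    ; independent = ≡.subst (λ xs → Independent (a zero ∷ xs)) (List.map-∘ B.I) (independent-∷ B.independent ¬s)
    ; nonzero = nonzero ; expansions = expansions ; triangular = triangular }
    where
    module B = Basis B
    nonzero : ∀ {p} → p ∈ zero ∷ List.map suc B.I → a p ≉ 0#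
    nonzero (here ≡.refl) e = ¬s (span-resp (sym e) (span-0 _))
    nonzero (there p∈) with ∈-map⁻ suc p∈
    ... | _ , p′∈ , ≡.refl = B.nonzero p′∈
    expansions : ∀ j → Expansion a (zero ∷ List.map suc B.I) (a j)
    expansions zero = self-expansion a B.I
    expansions (suc j) = weaken-expansion (lift-expansion (B.expansions j) refl) map-suc-≢0
    triangular : ∀ j p → p Fin.< j → Expansion.coef (expansions j) p ≈ 0#
    triangular (suc j) zero _ = refl
    triangular (suc j) (suc p) (s≤s lt) = B.triangular j p lt

-- Coloured points and representations of the top part

-- Points of PG(n-1, 1+Q) of weight at most w, normalised so that the last nonzero coordinate is 1;
-- coordinates are read from the left, 'put i' being a nonzero one and 'here' the final 1.
data Point (Q : ℕ) : ℕ → ℕ → Set where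
  here : ∀ {n w} → Point Q (suc n) (suc w)
  skip : ∀ {n w} → Point Q n (suc w) → Point Q (suc n) (suc w)
  put  : ∀ {n w} → Fin Q → Point Q n w → Point Q (suc n) (suc w)

last : ∀ {Q n w} → Point Q n w → Fin n
last here = zero
last (skip v) = suc (last v)
last (put _ v) = suc (last v)

-- Telling unit vectors apart lets vectors of weight at most 2 be represented with three distinct colours.
colour : ∀ {Q n w} → Point Q n w → Fin n ⊎ Fin n
colour here = inj₁ zero
colour (skip v) = Sum.map suc suc (colour v)
colour (put _ v) = inj₂ (suc (last v))

-- Since the colour determines the last position, points with different last positions have
-- different colours.
colour-last : ∀ {Q n w} (v : Point Q n w) → [ id , id ]′ (colour v) ≡ last v
colour-last here = ≡.refl
colour-last (skip v) with colour v | colour-last v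
... | inj₁ _ | e = ≡.cong suc e
... | inj₂ _ | e = ≡.cong suc e
colour-last (put _ v) = ≡.refl

unit : ∀ {Q n w} → Fin n → Point Q n (suc w)
unit zero = here
unit (suc i) = skip (unit i)

colour-unit : ∀ {Q n w} (i : Fin n) → colour (unit {Q} {n} {w} i) ≡ inj₁ i
colour-unit zero = ≡.refl
colour-unit {Q} {w = w} (suc i) rewrite colour-unit {Q} {w = w} i = ≡.refl

distinct-from-both : ∀ {n} (i j : Fin (suc (suc (suc n)))) → Σ (Fin (suc (suc (suc n)))) λ l → l ≢ i × l ≢ j
distinct-from-both zero zero = suc zero , (λ ()) , λ ()
distinct-from-both zero (suc zero) = suc (suc zero) , (λ ()) , λ ()
distinct-from-both zero (suc (suc _)) = suc zero , (λ ()) , λ ()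
distinct-from-both (suc zero) zero = suc (suc zero) , (λ ()) , λ ()
distinct-from-both (suc (suc _)) zero = suc zero , (λ ()) , λ ()
distinct-from-both (suc _) (suc _) = zero , (λ ()) , λ ()

module Representations (F : Field) (p j k r : ℕ) (p-prime : Prime p) (q′≡p^j : suc (suc k) ≡ p ℕ.^ j)
                       (enum : HasSize F (suc (suc k) ℕ.^ suc r)) where
  open Greedy F p j k r p-prime q′≡p^j enum public

  Pt : ℕ → ℕ → Set
  Pt = Point Q

  entry : ∀ {n w} → Pt n w → Fin n → Carrier
  entry here zero = 1#
  entry here (suc _) = 0#
  entry (skip v) zero = 0#
  entry (skip v) (suc h) = entry v h
  entry (put i v) zero = κ (suc i)
  entry (put i v) (suc h) = entry v h

  entry-K : ∀ {n w} (v : Pt n w) h → K (entry v h)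
  entry-K here zero = K-1
  entry-K here (suc _) = K-0
  entry-K (skip v) zero = K-0
  entry-K (skip v) (suc h) = entry-K v h
  entry-K (put i v) zero = κ-K (suc i)
  entry-K (put i v) (suc h) = entry-K v h

  unit-≡ : ∀ {n w} (i : Fin n) → entry (unit {w = w} i) i ≈ 1#
  unit-≡ zero = refl
  unit-≡ (suc i) = unit-≡ i

  unit-≢ : ∀ {n w} {i h : Fin n} → i ≢ h → entry (unit {w = w} i) h ≈ 0#
  unit-≢ {i = zero} {zero} ne = contradiction ≡.refl ne
  unit-≢ {i = zero} {suc h} ne = refl
  unit-≢ {i = suc i} {zero} ne = refl
  unit-≢ {i = suc i} {suc h} ne = unit-≢ {i = i} {h} (ne ∘ ≡.cong suc)

  entry-unit : ∀ {n w w′} (i h : Fin n) → entry (unit {w = w} i) h ≈ entry (unit {w = w′} i) h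
  entry-unit zero zero = refl
  entry-unit zero (suc h) = refl
  entry-unit (suc i) zero = refl
  entry-unit (suc i) (suc h) = entry-unit i h

  private
    one : Fin Q
    one = proj₁ (κ-surjective⁺ K-1 1≉0)
    κ-one : κ (suc one) ≈ 1#
    κ-one = proj₂ (κ-surjective⁺ K-1 1≉0)

  pair : ∀ {n w} (i j : Fin n) → i ≢ j → Σ (Pt n (suc (suc w))) λ v →
    (∀ h → entry v h ≈ entry (unit {w = 0} i) h + entry (unit {w = 0} j) h)
  pair zero zero ne = contradiction ≡.refl ne
  pair zero (suc j) ne = put one (unit j) , λ { zero → trans κ-one (sym (+-identityʳ _)) ; (suc h) → trans (entry-unit j h) (sym (+-identityˡ _)) }
  pair (suc i) zero ne = let v , e = pair zero (suc i) (ne ∘ ≡.sym) in v , λ h → trans (e h) (+-comm _ _)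
  pair (suc i) (suc j) ne = let v , e = pair i j (ne ∘ ≡.cong suc) in
    skip v , λ { zero → sym (+-identityʳ _) ; (suc h) → e h }

  -- The condition on the colour allows the point `e_i + e_j + e_l` to be used next to unit points
  -- in one representation, even next to `e_i`, `e_j` and `e_l`.
  triple : ∀ {n w} (i j l : Fin n) → i ≢ j → i ≢ l → j ≢ l → Σ (Pt n (suc (suc (suc w)))) λ v →
    (∀ m → colour v ≢ inj₁ m) ×
    (∀ h → entry v h ≈ (entry (unit {w = 0} i) h + entry (unit {w = 0} j) h) + entry (unit {w = 0} l) h)
  triple zero zero _ i≢j _ _ = contradiction ≡.refl i≢j
  triple zero (suc _) zero _ i≢l _ = contradiction ≡.refl i≢l
  triple (suc _) zero zero _ _ j≢l = contradiction ≡.refl j≢l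
  triple zero (suc j) (suc l) i≢j i≢l j≢l = let v , e = pair j l (j≢l ∘ ≡.cong suc) in
    put one v , (λ _ ()) , λ
    { zero → trans κ-one (sym (trans (+-identityʳ _) (+-identityʳ _)))
    ; (suc h) → trans (e h) (+-congʳ (sym (+-identityˡ _))) }
  triple (suc i) zero (suc l) i≢j i≢l j≢l =
    let v , c , e = triple zero (suc i) (suc l) (i≢j ∘ ≡.sym) j≢l i≢l in
    v , c , λ h → trans (e h) (+-congʳ (+-comm _ _))
  triple (suc i) (suc j) zero i≢j i≢l j≢l =
    let v , c , e = triple zero (suc i) (suc j) (i≢l ∘ ≡.sym) (j≢l ∘ ≡.sym) i≢j in
    v , c , λ h → trans (e h) (trans (+-assoc _ _ _) (+-comm _ _))
  triple (suc i) (suc j) (suc l) i≢j i≢l j≢l =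
    let v , c , e = triple i j l (i≢j ∘ ≡.cong suc) (i≢l ∘ ≡.cong suc) (j≢l ∘ ≡.cong suc) in
    skip v , not-unit v c , λ { zero → sym (trans (+-identityʳ _) (+-identityʳ _)) ; (suc h) → e h }
    where
    not-unit : ∀ {n w} (v : Pt n (suc w)) → (∀ m → colour v ≢ inj₁ m) → ∀ m → colour (skip v) ≢ inj₁ m
    not-unit v c m eq with colour v
    ... | inj₁ m′ = c m′ ≡.refl
    not-unit v c m () | inj₂ _

  support : ∀ {n} → (Fin n → Carrier) → List (Fin n)
  support {zero} v = []
  support {suc n} v with v zero ≟ 0#
  ... | yes _ = List.map suc (support (v ∘ suc))
  ... | no  _ = zero ∷ List.map suc (support (v ∘ suc))

  support-unique : ∀ {n} (v : Fin n → Carrier) → Unique (support v)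
  support-unique {zero} v = []
  support-unique {suc n} v with v zero ≟ 0#
  ... | yes _ = Unique.map⁺ Fin.suc-injective (support-unique (v ∘ suc))
  ... | no  _ = All.tabulate (λ { 0∈ ≡.refl → map-suc-≢0 0∈ }) ∷ Unique.map⁺ Fin.suc-injective (support-unique (v ∘ suc))

  ∈-support⁻ : ∀ {n} {v : Fin n → Carrier} {h} → h ∈ support v → v h ≉ 0#
  ∈-support⁻ {suc n} {v} h∈ with v zero ≟ 0#
  ∈-support⁻ {suc n} {v} h∈ | yes _ with ∈-map⁻ Fin.suc h∈
  ... | h′ , h′∈ , ≡.refl = ∈-support⁻ {n} {v ∘ suc} h′∈
  ∈-support⁻ {suc n} {v} (here ≡.refl) | no ne = ne
  ∈-support⁻ {suc n} {v} (there h∈) | no ne with ∈-map⁻ Fin.suc h∈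
  ... | h′ , h′∈ , ≡.refl = ∈-support⁻ {n} {v ∘ suc} h′∈

  ∈-support⁺ : ∀ {n} {v : Fin n → Carrier} {h} → v h ≉ 0# → h ∈ support v
  ∈-support⁺ {suc n} {v} {h} ne with v zero ≟ 0#
  ∈-support⁺ {suc n} {v} {zero} ne | yes e = contradiction e ne
  ∈-support⁺ {suc n} {v} {suc h} ne | yes _ = ∈-map⁺ Fin.suc (∈-support⁺ {n} {v ∘ suc} ne)
  ∈-support⁺ {suc n} {v} {zero} ne | no _ = here ≡.refl
  ∈-support⁺ {suc n} {v} {suc h} ne | no _ = there (∈-map⁺ Fin.suc (∈-support⁺ {n} {v ∘ suc} ne))

  ∉-support : ∀ {n} {v : Fin n → Carrier} {h} → h ∉ support v → v h ≈ 0#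
  ∉-support {v = v} {h} h∉ with v h ≟ 0#
  ... | yes e = e
  ... | no ne = contradiction (∈-support⁺ {v = v} ne) h∉

  point : ∀ {n w} (v : Fin n → Carrier) p → v p ≈ 1# → (∀ h → p Fin.< h → v h ≈ 0#) → (∀ h → K (v h)) →
    length (support v) ≤ w → Σ (Pt n w) λ x → (∀ h → entry x h ≈ v h) × (last x ≡ p)
  point {suc n} v p vp≈1 v≈0 kv le with v zero ≟ 0#
  point {suc n} v zero vp≈1 v≈0 kv le | yes e = contradiction (trans (sym vp≈1) e) 1≉0
  -- Weight bound 0 is refuted by exposing the support of the tail as nonempty: it contains `p`.
  point {suc n} {zero} v (suc p) vp≈1 v≈0 kv le | yes e with ∈-support⁺ {v = v ∘ suc} {p} (λ z → 1≉0 (trans (sym vp≈1) z))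
  ... | p∈ with support (v ∘ suc)
  point {suc n} {zero} v (suc p) vp≈1 v≈0 kv () | yes e | p∈ | _ ∷ _
  point {suc n} {suc w} v (suc p) vp≈1 v≈0 kv le | yes e
    with point {n} {suc w} (v ∘ suc) p vp≈1 (λ h lt → v≈0 (suc h) (s≤s lt)) (kv ∘ suc) (≡.subst (_≤ suc w) (List.length-map suc (support (v ∘ suc))) le)
  ... | x , ex , lx = skip x , (λ { zero → sym e ; (suc h) → ex h }) , ≡.cong suc lx
  point {suc n} {suc w} v zero vp≈1 v≈0 kv le | no ne = here , (λ { zero → sym vp≈1 ; (suc h) → sym (v≈0 (suc h) (s≤s z≤n)) }) , ≡.refl
  point {suc n} {suc w} v (suc p) vp≈1 v≈0 kv (s≤s le) | no ne
    with point {n} {w} (v ∘ suc) p vp≈1 (λ h lt → v≈0 (suc h) (s≤s lt)) (kv ∘ suc) (≡.subst (_≤ w) (List.length-map suc (support (v ∘ suc))) le)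
       | κ-surjective⁺ (kv zero) ne
  ... | x , ex , lx | i , ei = put i x , (λ { zero → ei ; (suc h) → ex h }) , ≡.cong suc lx

  -- The conditions under which the concatenation construction can complete a representation of a.
  record Representation (n w : ℕ) (a : Fin n → Carrier) : Set where
    field
      terms : List (Carrier × Pt n w)
      nonzero : All (λ t → proj₁ t ≉ 0#) terms
      distinct : AllPairs (λ s t → colour (proj₂ s) ≢ colour (proj₂ t)) terms
      length≥3 : 3 ≤ length terms
      length≤R : length terms ≤ R
      represents : ∀ h → a h ≈ sumL (λ t → proj₁ t * entry (proj₂ t) h) terms

  -- Shared by medium and large weights. Each position of `P` carries one point ending there, so the
  -- absence of repetitions in `P` makes the colours distinct.
  onPositions : ∀ {n w} (a : Fin n → Carrier) (P : List (Fin n)) (x : Fin n → Pt n w) → (∀ p → last (x p) ≡ p) →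
    Unique P → (∀ {p} → p ∈ P → a p ≉ 0#) → 3 ≤ length P → length P ≤ R →
    (∀ h → a h ≈ sumL (λ p → a p * entry (x p) h) P) → Representation n w a
  onPositions a P x last-x u nz l≥ l≤ e = record
    { terms = List.map t P
    ; nonzero = All.map⁺ (All.tabulate nz)
    ; distinct = AllPairs.map⁺ (AllPairs.map (λ {p} {q} ne eq → ne (≡.trans (≡.sym (last-x p))
        (≡.trans (≡.sym (colour-last (x p))) (≡.trans (≡.cong [ id , id ]′ eq) (≡.trans (colour-last (x q)) (last-x q)))))) u)
    ; length≥3 = ≡.subst (3 ≤_) (≡.sym (List.length-map t P)) l≥
    ; length≤R = ≡.subst (_≤ R) (≡.sym (List.length-map t P)) l≤
    ; represents = λ h → trans (e h) (reflexive (≡.sym (sumL-map t P))) }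
    where t = λ p → a p , x p

  last-unit : ∀ {n w} (i : Fin n) → last (unit {Q} {n} {w} i) ≡ i
  last-unit zero = ≡.refl
  last-unit (suc i) = ≡.cong suc (last-unit i)

  represent-medium : ∀ {n w} (a : Fin n → Carrier) → 3 ≤ length (support a) → length (support a) ≤ R → Representation n (suc w) a
  represent-medium {n} {w} a l≥ l≤ = onPositions a (support a) unit last-unit (support-unique a) (∈-support⁻ {v = a}) l≥ l≤ sums
    where
    sums : ∀ h → a h ≈ sumL (λ p → a p * entry (unit {w = w} p) h) (support a)
    sums h with h ∈? support a
    ... | yes h∈ = sym (trans (sumL-single (support-unique a) h∈ (λ ne → trans (*-congˡ (unit-≢ ne)) (zeroʳ _)))
                     (trans (*-congˡ (unit-≡ h)) (*-identityʳ _)))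
    ... | no h∉ = trans (∉-support {v = a} h∉) (sym (sumL-0 (support a) λ {p} p∈ → trans (*-congˡ (unit-≢ {i = p} (λ { ≡.refl → h∉ p∈ }))) (zeroʳ _)))

  module _ {n w : ℕ} (n<w+R : n ℕ.< w ℕ.+ R) (a : Fin n → Carrier) (3≤R : 3 ≤ R) (R≤ : R ≤ length (support a)) where
    private
      module B = Basis (basis a)
      extension = extend B.I (support a) R B.unique (support-unique a) B.length≤R R≤
      E = proj₁ extension
      P = B.I ++ E
      P-unique = proj₁ (proj₂ extension)
      P-length = proj₁ (proj₂ (proj₂ extension))

      P-nonzero : ∀ {p} → p ∈ P → a p ≉ 0#
      P-nonzero p∈ with ∈-++⁻ B.I p∈
      ... | inj₁ p∈I = B.nonzero p∈I
      ... | inj₂ p∈E = ∈-support⁻ {v = a} (proj₂ (proj₂ (proj₂ extension)) p∈E)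

      c : Fin n → Fin n → Carrier
      c p h = Expansion.coef (B.expansions h) p

      -- On `P` this is the unit vector at `p`; elsewhere it holds the coefficients of `a p` in the
      -- expansions of the other entries. For `p` in `E` those coefficients vanish and the whole
      -- vector is a unit vector.
      u : Fin n → Fin n → Carrier
      u p h with h Fin.≟ p | h ∈? P
      ... | yes _ | _ = 1#
      ... | no _ | yes _ = 0#
      ... | no _ | no _ = c p h

      u-diagonal : ∀ p → u p p ≈ 1#
      u-diagonal p with p Fin.≟ p | p ∈? P
      ... | yes _ | _ = refl
      ... | no ne | _ = contradiction ≡.refl ne

      u-∈ : ∀ {p h} → h ≢ p → h ∈ P → u p h ≈ 0#
      u-∈ {p} {h} h≢p h∈ with h Fin.≟ p | h ∈? P
      ... | yes e | _ = contradiction e h≢p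
      ... | no _ | yes _ = refl
      ... | no _ | no h∉ = contradiction h∈ h∉

      u-∉ : ∀ {p h} → h ≢ p → h ∉ P → u p h ≈ c p h
      u-∉ {p} {h} h≢p h∉ with h Fin.≟ p | h ∈? P
      ... | yes e | _ = contradiction e h≢p
      ... | no _ | yes h∈ = contradiction h∈ h∉
      ... | no _ | no _ = refl

      u-K : ∀ p h → K (u p h)
      u-K p h with h Fin.≟ p | h ∈? P
      ... | yes _ | _ = K-1
      ... | no _ | yes _ = K-0
      ... | no _ | no _ = Expansion.coef-K (B.expansions h) p

      u-triangular : ∀ p h → p Fin.< h → u p h ≈ 0#
      u-triangular p h p<h with h Fin.≟ p | h ∈? P
      ... | yes e | _ = contradiction (≡.cong Fin.toℕ (≡.sym e)) (ℕ.<⇒≢ p<h)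
      ... | no _ | yes _ = refl
      ... | no _ | no _ = B.triangular h p p<h

      -- Apart from `p` the support avoids the `R` positions of `P`, so the weight is at most
      -- `1 + (n - R)`.
      u-weight : ∀ p → length (support (u p)) ≤ w
      u-weight p = ℕ.+-cancelʳ-≤ R _ _ (ℕ.≤-trans (ℕ.+-monoˡ-≤ R (unique-⊆-length (support-unique (u p)) cover))
        (ℕ.≤-trans (s≤s bound) n<w+R))
        where
        P? = λ h → ¬? (h Fin.≟ p)
        X = filter P? (support (u p))
        cover : ∀ {h} → h ∈ support (u p) → h ∈ p ∷ X
        cover {h} h∈ with h Fin.≟ p
        ... | yes e = here e
        ... | no ne = there (∈-filter⁺ P? h∈ ne)
        disjoint : ∀ {h} → (h ∈ X × h ∈ P) → ⊥
        disjoint (h∈X , h∈P) with ∈-filter⁻ P? h∈X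
        ... | h∈ , ne = ∈-support⁻ {v = u p} h∈ (u-∈ ne h∈P)
        bound : length X ℕ.+ R ≤ n
        bound = ≡.subst (_≤ n) (≡.trans (List.length-++ X) (≡.cong (length X ℕ.+_) P-length))
          (unique-length (Unique.++⁺ (Unique.filter⁺ P? (support-unique (u p))) P-unique disjoint))

      x : ∀ p → Σ (Pt n w) λ x → (∀ h → entry x h ≈ u p h) × (last x ≡ p)
      x p = point (u p) p (u-diagonal p) (u-triangular p) (u-K p) (u-weight p)

      sums : ∀ h → a h ≈ sumL (λ p → a p * u p h) P
      sums h = by-membership (h ∈? P)
       where
       by-membership : Dec (h ∈ P) → a h ≈ sumL (λ p → a p * u p h) P
       by-membership (yes h∈) = sym (trans (sumL-single P-unique h∈ (λ ne → trans (*-congˡ (u-∈ (ne ∘ ≡.sym) h∈)) (zeroʳ _)))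
                       (trans (*-congˡ (u-diagonal h)) (*-identityʳ _)))
       -- The expansion over the basis positions may be summed over all of `P`, as its coefficients
       -- vanish on `E`.
       by-membership (no h∉) = begin
        a h ≈⟨ Ex.expand ⟩
        sumL (λ p → c p h * a p) B.I ≈⟨ +-identityʳ _ ⟨
        sumL (λ p → c p h * a p) B.I + 0# ≈⟨ +-congˡ (sumL-0 E λ p∈ → trans (*-congʳ (Ex.coef-support _ λ p∈I →
             E-disjoint B.I P-unique p∈I p∈)) (zeroˡ _)) ⟨
        sumL (λ p → c p h * a p) B.I + sumL (λ p → c p h * a p) E ≈⟨ sumL-++ B.I E ⟨
        sumL (λ p → c p h * a p) P ≈⟨ sumL-cong P (λ p∈ → trans (*-comm _ _) (*-congˡ (sym (u-∉ (λ { ≡.refl → h∉ p∈ }) h∉)))) ⟩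
        sumL (λ p → a p * u p h) P ∎
        where
        module Ex = Expansion (B.expansions h)
        E-disjoint : ∀ (I : List (Fin n)) {E} → Unique (I ++ E) → ∀ {p} → p ∈ I → p ∈ E → ⊥
        E-disjoint (i ∷ I) (i∉ ∷ _) (here ≡.refl) p∈E = All.lookup i∉ (∈-++⁺ʳ I p∈E) ≡.refl
        E-disjoint (i ∷ I) (_ ∷ u) (there p∈I) p∈E = E-disjoint I u p∈I p∈E

    represent-large : Representation n w a
    represent-large = onPositions a P (proj₁ ∘ x) (λ p → proj₂ (proj₂ (x p))) P-unique P-nonzero
      (≡.subst (3 ≤_) (≡.sym P-length) 3≤R) (ℕ.≤-reflexive P-length)
      (λ h → trans (sums h) (sumL-cong P λ {p} _ → *-congˡ (sym (proj₁ (proj₂ (x p)) h))))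

  avoid : 3 ≤ q′ ℕ.^ R → ∀ x y → Σ Carrier λ c → c ≉ x × c ≉ y
  avoid 3≤ x y with others 3≤ (from x) (from y)
    where
    others : ∀ {N} → 3 ≤ N → (i j : Fin N) → Σ (Fin N) λ l → l ≢ i × l ≢ j
    others (s≤s (s≤s (s≤s _))) = distinct-from-both
  ... | l , l≢x , l≢y = to l , lift l≢x , lift l≢y
    where
    lift : ∀ {l z} → l ≢ from z → to l ≉ z
    lift ne e = ne (≡.trans (≡.sym (from-to _)) (from-cong e))

  module _ {n w : ℕ} (4≤R : 4 ≤ R) (3≤q : 3 ≤ q′ ℕ.^ R) (a : Fin n → Carrier) {i j l : Fin n}
           (i≢j : i ≢ j) (i≢l : i ≢ l) (j≢l : j ≢ l) (a≈0 : ∀ h → h ≢ i → h ≢ j → a h ≈ 0#) where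
    private
      W : ℕ
      W = suc (suc (suc w))
      e : Fin n → Pt n W
      e = unit
      c = proj₁ (avoid 3≤q 0# (a i))
      c≉0 = proj₁ (proj₂ (avoid 3≤q 0# (a i)))
      c≉aᵢ = proj₂ (proj₂ (avoid 3≤q 0# (a i)))
      v = proj₁ (triple {w = w} i j l i≢j i≢l j≢l)
      v-colour = proj₁ (proj₂ (triple {w = w} i j l i≢j i≢l j≢l))

      v-entry : ∀ h → entry v h ≈ (entry (e i) h + entry (e j) h) + entry (e l) h
      v-entry h = trans (proj₂ (proj₂ (triple {w = w} i j l i≢j i≢l j≢l)) h) (+-cong (+-cong (entry-unit i h) (entry-unit j h)) (entry-unit l h))

      -c≉0 : - c ≉ 0#
      -c≉0 z = c≉0 (trans (sym (-‿involutive c)) (trans (-‿cong z) -0#≈0#))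

      aᵢ-c≉0 : a i - c ≉ 0#
      aᵢ-c≉0 z = c≉aᵢ (sym (x-y≈0⇒x≈y z))

      v≢e : ∀ m → colour v ≢ colour (e m)
      v≢e m eq = v-colour m (≡.trans eq (colour-unit m))

      e≢e : ∀ {m m′} → m ≢ m′ → colour (e m) ≢ colour (e m′)
      e≢e {m} {m′} ne eq with ≡.trans (≡.sym (colour-unit {Q} {w = suc (suc w)} m)) (≡.trans eq (colour-unit m′))
      ... | ≡.refl = ne ≡.refl

      a-units : ∀ h → a h ≈ a i * entry (e i) h + a j * entry (e j) h
      a-units h with h Fin.≟ i | h Fin.≟ j
      ... | yes ≡.refl | _ = sym (trans (+-cong (trans (*-congˡ (unit-≡ h)) (*-identityʳ _)) (trans (*-congˡ (unit-≢ (i≢j ∘ ≡.sym))) (zeroʳ _))) (+-identityʳ _))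
      ... | no _ | yes ≡.refl = sym (trans (+-cong (trans (*-congˡ (unit-≢ i≢j)) (zeroʳ _)) (trans (*-congˡ (unit-≡ h)) (*-identityʳ _))) (+-identityˡ _))
      ... | no h≢i | no h≢j = trans (a≈0 h h≢i h≢j) (sym (trans (+-cong (trans (*-congˡ (unit-≢ (h≢i ∘ ≡.sym))) (zeroʳ _)) (trans (*-congˡ (unit-≢ (h≢j ∘ ≡.sym))) (zeroʳ _))) (+-identityˡ _)))

      four-terms : ∀ h → a h ≈ c * entry v h + (- c * entry (e l) h + ((a i - c) * entry (e i) h + ((a j - c) * entry (e j) h)))
      four-terms h = begin
        a h ≈⟨ a-units h ⟩
        a i * entry (e i) h + a j * entry (e j) h
          ≈⟨ solve 6 (λ x y c i j l → x :* i :+ y :* j :=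
               c :* (i :+ j :+ l) :+ (:- c :* l :+ ((x :- c) :* i :+ (y :- c) :* j))) refl (a i) (a j) c _ _ _ ⟩
        c * ((entry (e i) h + entry (e j) h) + entry (e l) h) + (- c * entry (e l) h + ((a i - c) * entry (e i) h + (a j - c) * entry (e j) h))
          ≈⟨ +-congʳ (*-congˡ (v-entry h)) ⟨
        c * entry v h + (- c * entry (e l) h + ((a i - c) * entry (e i) h + (a j - c) * entry (e j) h)) ∎
        where open IC

    -- a = c (e_i + e_j + e_l) - c e_l + (a_i - c) e_i + (a_j - c) e_j; three nonzero coefficients suffice,
    -- so only c and a_i - c have to be kept away from 0.
    represent-small : Representation n W a
    represent-small with a j - c ≟ 0#
    ... | yes z = record
      { terms = (c , v) ∷ (- c , e l) ∷ (a i - c , e i) ∷ []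
      ; nonzero = c≉0 ∷ -c≉0 ∷ aᵢ-c≉0 ∷ []
      ; distinct = (v≢e l ∷ v≢e i ∷ []) ∷ (e≢e (i≢l ∘ ≡.sym) ∷ []) ∷ [] ∷ []
      ; length≥3 = s≤s (s≤s (s≤s z≤n))
      ; length≤R = ℕ.≤-trans (s≤s (s≤s (s≤s z≤n))) 4≤R
      ; represents = λ h → trans (four-terms h) (+-congˡ (+-congˡ (+-congˡ (trans (*-congʳ z) (zeroˡ _))))) }
    ... | no nz = record
      { terms = (c , v) ∷ (- c , e l) ∷ (a i - c , e i) ∷ (a j - c , e j) ∷ []
      ; nonzero = c≉0 ∷ -c≉0 ∷ aᵢ-c≉0 ∷ nz ∷ []
      ; distinct = (v≢e l ∷ v≢e i ∷ v≢e j ∷ []) ∷ (e≢e (i≢l ∘ ≡.sym) ∷ e≢e (j≢l ∘ ≡.sym) ∷ []) ∷ (e≢e i≢j ∷ []) ∷ [] ∷ []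
      ; length≥3 = s≤s (s≤s (s≤s z≤n))
      ; length≤R = 4≤R
      ; represents = λ h → trans (four-terms h) (+-congˡ (+-congˡ (+-congˡ (sym (+-identityʳ _))))) }

  -- Weights at least `R`, from 3 up to `R`, and at most 2 are treated separately. No vector may be
  -- given fewer than three terms, since the first three lower blocks have no simplex columns and
  -- may be nonzero even if `a` is zero.
  represent : ∀ {n w} → 4 ≤ R → 3 ≤ q′ ℕ.^ R → n ℕ.< w ℕ.+ R → 3 ≤ n → 3 ≤ w → (a : Fin n → Carrier) → Representation n w a
  represent {suc (suc (suc n))} {suc (suc (suc w))} 4≤R 3≤q n< (s≤s (s≤s (s≤s _))) (s≤s (s≤s (s≤s _))) a = by-weight (R ℕ.≤? length (support a))
    where
    Rep = Representation (suc (suc (suc n))) (suc (suc (suc w))) a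
    from-two : ∀ i j → i ≢ j → (∀ h → h ≢ i → h ≢ j → a h ≈ 0#) → Rep
    from-two i j i≢j z = let l , l≢i , l≢j = distinct-from-both i j in
      represent-small 4≤R 3≤q a i≢j (l≢i ∘ ≡.sym) (l≢j ∘ ≡.sym) z
    by-support : ∀ L → support a ≡ L → Unique L → length L ≤ R → (∀ {h} → h ∉ L → a h ≈ 0#) → Rep
    -- With fewer than two nonzero entries, the missing positions are filled by arbitrary distinct
    -- ones where `a` vanishes.
    by-support [] _ _ _ z = from-two zero (suc zero) (λ ()) (λ h _ _ → z (λ ()))
    by-support (i ∷ []) _ _ _ z = let j , j≢i , _ = distinct-from-both i i in
      from-two i j (j≢i ∘ ≡.sym) (λ h h≢i _ → z (λ { (here e) → h≢i e }))
    by-support (i ∷ j ∷ []) _ ((i≢j ∷ []) ∷ _) _ z =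
      from-two i j i≢j (λ h h≢i h≢j → z (λ { (here e) → h≢i e ; (there (here e)) → h≢j e }))
    by-support (_ ∷ _ ∷ _ ∷ _) eq _ le _ = represent-medium a
      (≡.subst (λ L → 3 ≤ length L) (≡.sym eq) (s≤s (s≤s (s≤s z≤n)))) (≡.subst (λ L → length L ≤ R) (≡.sym eq) le)
    by-weight : Dec (R ≤ length (support a)) → Rep
    by-weight (yes le) = represent-large n< a (ℕ.≤-trans (ℕ.n≤1+n 3) 4≤R) le
    by-weight (no nle) = by-support (support a) ≡.refl (support-unique a) (ℕ.<⇒≤ (ℕ.≰⇒> nle)) (∉-support {v = a})

-- Counting points, simplex columns and colours

pointCount : ℕ → ℕ → ℕ → ℕ
pointCount Q zero w = 0
pointCount Q (suc n) zero = 0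
pointCount Q (suc n) (suc w) = suc (pointCount Q n (suc w) ℕ.+ Q ℕ.* pointCount Q n w)

decodePoint : ∀ {Q} n w → Fin (pointCount Q n w) → Point Q n w
decodePoint {Q} (suc n) (suc w) zero = here
decodePoint {Q} (suc n) (suc w) (suc i) = [ skip ∘ decodePoint n (suc w) ,
  (λ j → put (proj₁ (remQuot {Q} (pointCount Q n w) j)) (decodePoint n w (proj₂ (remQuot {Q} (pointCount Q n w) j)))) ]′
  (splitAt (pointCount Q n (suc w)) i)

encodePoint : ∀ {Q n w} → Point Q n w → Fin (pointCount Q n w)
encodePoint here = zero
encodePoint (skip v) = suc (encodePoint v ↑ˡ _)
encodePoint {Q} {suc n} {suc w} (put c v) = suc (pointCount Q n (suc w) ↑ʳ combine c (encodePoint v))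

decode-encode : ∀ {Q n w} (v : Point Q n w) → decodePoint n w (encodePoint v) ≡ v
decode-encode here = ≡.refl
decode-encode {Q} {suc n} {suc w} (skip v)
  rewrite Fin.splitAt-↑ˡ (pointCount Q n (suc w)) (encodePoint v) (Q ℕ.* pointCount Q n w) = ≡.cong skip (decode-encode v)
decode-encode {Q} {suc n} {suc w} (put c v)
  rewrite Fin.splitAt-↑ʳ (pointCount Q n (suc w)) (Q ℕ.* pointCount Q n w) (combine c (encodePoint v)) =
  ≡.trans (≡.cong (λ u → put (proj₁ u) (decodePoint n w (proj₂ u))) (Fin.remQuot-combine c (encodePoint v)))
    (≡.cong (put c) (decode-encode v))

-- The number of nonzero vectors of length `n` and weight at most `w` over a field of `1 + Q`
-- elements; it is the numerator in `nGamma`.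
weightSum : ℕ → ℕ → ℕ → ℕ
weightSum Q n w = ∑ℕ₁ w (λ i → Q ℕ.^ i ℕ.* (n C i))

-- Pascal's rule. Combinatorially, the first entry is zero, or one of `Q` nonzero values followed by
-- a zero or a nonzero tail.
weightSum-suc : ∀ Q n w → weightSum Q (suc n) (suc w) ≡ weightSum Q n (suc w) ℕ.+ (Q ℕ.+ Q ℕ.* weightSum Q n w)
weightSum-suc Q n zero = begin
  Q ℕ.* 1 ℕ.* (suc n C 1) ≡⟨ ≡.cong (Q ℕ.* 1 ℕ.*_) (≡.trans (nC1≡n (suc n)) (≡.cong suc (≡.sym (nC1≡n n)))) ⟩
  Q ℕ.* 1 ℕ.* suc (n C 1) ≡⟨ lemma Q (n C 1) ⟩
  Q ℕ.* 1 ℕ.* (n C 1) ℕ.+ (Q ℕ.+ Q ℕ.* 0) ∎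
  where
  open ≡.≡-Reasoning
  lemma : ∀ Q c → Q ℕ.* 1 ℕ.* suc c ≡ Q ℕ.* 1 ℕ.* c ℕ.+ (Q ℕ.+ Q ℕ.* 0)
  lemma = ℕ-solve-∀
weightSum-suc Q n (suc w) = begin
  weightSum Q (suc n) (suc w) ℕ.+ Q ℕ.* Qw ℕ.* (suc n C suc (suc w))
    ≡⟨ ≡.cong₂ (λ s c → s ℕ.+ Q ℕ.* Qw ℕ.* c) (weightSum-suc Q n w) (≡.sym (nCk+nC[k+1]≡[n+1]C[k+1] n (suc w))) ⟩
  (S₁ ℕ.+ (Q ℕ.+ Q ℕ.* S)) ℕ.+ Q ℕ.* Qw ℕ.* ((n C suc w) ℕ.+ (n C suc (suc w)))
    ≡⟨ lemma Q Qw S₁ S (n C suc w) (n C suc (suc w)) ⟩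
  (S₁ ℕ.+ Q ℕ.* Qw ℕ.* (n C suc (suc w))) ℕ.+ (Q ℕ.+ Q ℕ.* (S ℕ.+ Qw ℕ.* (n C suc w))) ∎
  where
  open ≡.≡-Reasoning
  S₁ = weightSum Q n (suc w)
  S = weightSum Q n w
  Qw = Q ℕ.^ suc w
  lemma : ∀ Q Qw S₁ S c d → (S₁ ℕ.+ (Q ℕ.+ Q ℕ.* S)) ℕ.+ Q ℕ.* Qw ℕ.* (c ℕ.+ d) ≡
    (S₁ ℕ.+ Q ℕ.* Qw ℕ.* d) ℕ.+ (Q ℕ.+ Q ℕ.* (S ℕ.+ Qw ℕ.* c))
  lemma = ℕ-solve-∀

-- Every point has `Q` nonzero scalar multiples; formally, both sides satisfy the same recursion.
-- This makes the division in `nGamma` exact.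
weightSum-count : ∀ Q n w → weightSum Q n w ≡ Q ℕ.* pointCount Q n w
weightSum-count Q zero zero = ≡.sym (ℕ.*-zeroʳ Q)
weightSum-count Q zero (suc w) = ≡.trans (≡.cong₂ ℕ._+_ (weightSum-count Q zero w)
  (≡.trans (≡.cong (Q ℕ.^ suc w ℕ.*_) (k>n⇒nCk≡0 (s≤s (z≤n {w})))) (ℕ.*-zeroʳ (Q ℕ.^ suc w)))) (ℕ.+-identityʳ _)
weightSum-count Q (suc n) zero = ≡.sym (ℕ.*-zeroʳ Q)
weightSum-count Q (suc n) (suc w) = begin
  weightSum Q (suc n) (suc w) ≡⟨ weightSum-suc Q n w ⟩
  weightSum Q n (suc w) ℕ.+ (Q ℕ.+ Q ℕ.* weightSum Q n w)
    ≡⟨ ≡.cong₂ (λ s t → s ℕ.+ (Q ℕ.+ Q ℕ.* t)) (weightSum-count Q n (suc w)) (weightSum-count Q n w) ⟩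
  Q ℕ.* B₁ ℕ.+ (Q ℕ.+ Q ℕ.* (Q ℕ.* B)) ≡⟨ lemma Q B₁ B ⟩
  Q ℕ.* suc (B₁ ℕ.+ Q ℕ.* B) ∎
  where
  open ≡.≡-Reasoning
  B₁ = pointCount Q n (suc w)
  B = pointCount Q n w
  lemma : ∀ Q B₁ B → Q ℕ.* B₁ ℕ.+ (Q ℕ.+ Q ℕ.* (Q ℕ.* B)) ≡ Q ℕ.* suc (B₁ ℕ.+ Q ℕ.* B)
  lemma = ℕ-solve-∀

nGamma-count : ∀ R k γ → nGamma R (suc (suc k)) γ ≡ pointCount (suc k) (R ℕ.+ γ) (suc γ)
nGamma-count R k γ = ≡.trans
  (≡.cong (ℕ._/ suc k) (≡.trans (weightSum-count (suc k) (R ℕ.+ γ) (suc γ)) (ℕ.*-comm (suc k) _)))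
  (m*n/n≡m (pointCount (suc k) (R ℕ.+ γ) (suc γ)) (suc k))

simplexCount : ℕ → ℕ → ℕ
simplexCount q zero = 0
simplexCount q (suc m) = q ℕ.^ m ℕ.+ simplexCount q m

simplexCount-div : ∀ q → 2 ≤ q → ∀ m → (q ℕ.^ m ∸ 1) div (q ∸ 1) ≡ simplexCount q m
simplexCount-div q@(suc (suc d)) _ m =
  ≡.trans (≡.cong (λ x → (x ∸ 1) ℕ./ suc d) (geometric-sum m)) (m*n/n≡m (simplexCount q m) (suc d))
  where
  lemma : ∀ d x s → x ≡ suc (s ℕ.* suc d) → suc (suc d) ℕ.* x ≡ suc ((x ℕ.+ s) ℕ.* suc d)
  lemma d _ s ≡.refl = identity d s
    where
    identity : ∀ d s → suc (suc d) ℕ.* suc (s ℕ.* suc d) ≡ suc ((suc (s ℕ.* suc d) ℕ.+ s) ℕ.* suc d)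
    identity = ℕ-solve-∀
  geometric-sum : ∀ m → q ℕ.^ m ≡ suc (simplexCount q m ℕ.* suc d)
  geometric-sum zero = ≡.refl
  geometric-sum (suc m) = lemma d (q ℕ.^ m) (simplexCount q m) (geometric-sum m)
simplexCount-div zero () m
simplexCount-div (suc zero) (s≤s ()) m

-- The 2(R+γ) ≤ 4R-2 colours fit into a field of q ≥ 2^R elements thanks to R ≥ 4.
colours-fit : ∀ k r γ → γ ≤ 3 ℕ.+ r → let n = (4 ℕ.+ r) ℕ.+ γ in n ℕ.+ n ≤ suc (suc k) ℕ.^ (4 ℕ.+ r)
colours-fit k r γ γ≤ = begin
  n ℕ.+ n ≤⟨ ℕ.+-mono-≤ n≤ n≤ ⟩
  ((4 ℕ.+ r) ℕ.+ (3 ℕ.+ r)) ℕ.+ ((4 ℕ.+ r) ℕ.+ (3 ℕ.+ r)) ≡⟨ lemma r ⟩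
  14 ℕ.+ 4 ℕ.* r ≤⟨ small r ⟩
  2 ℕ.^ (4 ℕ.+ r) ≤⟨ ℕ.^-monoˡ-≤ (4 ℕ.+ r) (s≤s (s≤s (z≤n {k}))) ⟩
  suc (suc k) ℕ.^ (4 ℕ.+ r) ∎
  where
  open ℕ.≤-Reasoning
  n = (4 ℕ.+ r) ℕ.+ γ
  n≤ = ℕ.+-monoʳ-≤ (4 ℕ.+ r) γ≤
  lemma : ∀ r → ((4 ℕ.+ r) ℕ.+ (3 ℕ.+ r)) ℕ.+ ((4 ℕ.+ r) ℕ.+ (3 ℕ.+ r)) ≡ 14 ℕ.+ 4 ℕ.* r
  lemma = ℕ-solve-∀
  double : ∀ r → 14 ℕ.+ 4 ℕ.* suc r ℕ.+ (10 ℕ.+ 4 ℕ.* r) ≡ 2 ℕ.* (14 ℕ.+ 4 ℕ.* r)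
  double = ℕ-solve-∀
  small : ∀ r → 14 ℕ.+ 4 ℕ.* r ≤ 2 ℕ.^ (4 ℕ.+ r)
  small zero = ℕ.m≤m+n 14 2
  small (suc r) = ℕ.≤-trans (ℕ.≤-trans (ℕ.m≤m+n _ (10 ℕ.+ 4 ℕ.* r)) (ℕ.≤-reflexive (double r))) (ℕ.*-monoʳ-≤ 2 (small r))

-- Counts corrections: each block needs at most one simplex column, and the first `j` blocks need
-- none.
length-concat : ∀ {X : Set} W (f : Fin W → List X) j → (∀ g → length (f g) ≤ 1) → (∀ g → toℕ g < j → f g ≡ []) →
  length (List.concat (List.tabulate f)) ≤ W ∸ j
length-concat zero f j _ _ = z≤n
length-concat (suc W) f zero le _ rewrite List.length-++ (f zero) {List.concat (List.tabulate (f ∘ suc))} =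
  ℕ.+-mono-≤ (le zero) (length-concat W (f ∘ suc) zero (le ∘ suc) (λ _ ()))
length-concat (suc W) f (suc j) le e rewrite e zero (s≤s z≤n) =
  length-concat W (f ∘ suc) j (le ∘ suc) (λ g lt → e (suc g) (s≤s lt))

-- Vandermonde systems and simplex columns

module Vandermonde (F : Field) {N} (enum : HasSize F N) where
  open FiniteField F enum
  open ListSums F

  -- The value at 0 is a default that makes the function total; no equation relies on it.
  inv : Carrier → Carrier
  inv x with x ≟ 0#
  ... | yes _ = 0#
  ... | no ne = proj₁ (inverse x ne)

  inv-inverse : ∀ {x} → x ≉ 0# → x * inv x ≈ 1#
  inv-inverse {x} x≉0 with x ≟ 0#
  ... | yes e = contradiction e x≉0
  ... | no ne = proj₂ (inverse x ne)

  module _ {A : Set} (β : A → Carrier) {m : ℕ} where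
    power-sum : ℕ → Fin m → List (A × (Fin m → Carrier)) → Carrier
    power-sum l μ = sumL (λ z → β (proj₁ z) ^ l * proj₂ z μ)

    private
      divide : Carrier → A × (Fin m → Carrier) → A × (Fin m → Carrier)
      divide c (s , y) = s , λ μ → inv (β s - c) * y μ

      -- With `x = y / (b - c)` one has `b ^ (l+1) x = c b ^ l x + b ^ l y`, summed over all
      -- unknowns.
      power-sum-divide : ∀ c l μ ys → All (λ y → c ≉ β (proj₁ y)) ys →
        power-sum (suc l) μ (List.map (divide c) ys) ≈ c * power-sum l μ (List.map (divide c) ys) + power-sum l μ ys
      power-sum-divide c l μ [] _ = sym (trans (+-identityʳ _) (zeroʳ c))
      power-sum-divide c l μ ((s , y) ∷ ys) (c≉ ∷ cs) = begin
        b * bˡ * (i * yμ) + power-sum (suc l) μ xs ≈⟨ +-congˡ (power-sum-divide c l μ ys cs) ⟩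
        b * bˡ * (i * yμ) + (c * Sx + Sy)
          ≈⟨ solve 7 (λ b bˡ i y c X Y → b :* bˡ :* (i :* y) :+ (c :* X :+ Y) :=
              c :* (bˡ :* (i :* y) :+ X) :+ (bˡ :* (((b :- c) :* i) :* y) :+ Y)) refl b bˡ i yμ c Sx Sy ⟩
        c * (bˡ * (i * yμ) + Sx) + (bˡ * (((b - c) * i) * yμ) + Sy)
          ≈⟨ +-congˡ (+-congʳ (*-congˡ (trans (*-congʳ (inv-inverse λ e → c≉ (sym (x-y≈0⇒x≈y e)))) (*-identityˡ yμ)))) ⟩
        c * (bˡ * (i * yμ) + Sx) + (bˡ * yμ + Sy) ∎
        where
        open IC
        xs = List.map (divide c) ys
        b = β s
        bˡ = b ^ l
        i = inv (b - c)
        yμ = y μ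
        Sx = power-sum l μ xs
        Sy = power-sum l μ ys

    -- Eliminating the first unknown turns the right-hand side b l into b (l+1) - β t * b l
    -- and multiplies each other unknown by β s - β t.
    vandermonde : ∀ (ts : List A) → AllPairs (λ s t → β s ≉ β t) ts → (b : ℕ → Fin m → Carrier) →
      Σ (List (A × (Fin m → Carrier))) λ xs → (List.map proj₁ xs ≡ ts) ×
        (∀ l → l < length ts → ∀ μ → power-sum l μ xs ≈ b l μ)
    vandermonde [] _ b = [] , ≡.refl , λ _ ()
    vandermonde (t ∷ ts) (t≉ ∷ d) b = (t , x₀) ∷ xs , ≡.cong (t ∷_) (≡.trans (≡.sym (List.map-∘ ys)) ys-ts) , solves
      where
      c = β t
      IH = vandermonde ts d (λ l μ → b (suc l) μ - c * b l μ)
      ys = proj₁ IH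
      ys-ts = proj₁ (proj₂ IH)
      ys-solves = proj₂ (proj₂ IH)
      xs = List.map (divide c) ys
      c≉ys : All (λ y → c ≉ β (proj₁ y)) ys
      c≉ys = All.map⁻ (≡.subst (All (λ s → c ≉ β s)) (≡.sym ys-ts) t≉)
      x₀ : Fin m → Carrier
      x₀ μ = b 0 μ - power-sum 0 μ xs
      solves : ∀ l → l < suc (length ts) → ∀ μ → c ^ l * x₀ μ + power-sum l μ xs ≈ b l μ
      solves zero _ μ = solve 2 (λ b s → con (+ 1) :* (b :- s) :+ s := b) refl _ _
        where open IC
              open import Data.Integer using (+_)
      solves (suc l) (s≤s lt) μ = begin
        c * c ^ l * x₀ μ + power-sum (suc l) μ xs ≈⟨ +-congˡ (power-sum-divide c l μ ys c≉ys) ⟩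
        c * c ^ l * x₀ μ + (c * power-sum l μ xs + power-sum l μ ys)
          ≈⟨ solve 5 (λ c d x s t → c :* d :* x :+ (c :* s :+ t) := c :* (d :* x :+ s) :+ t) refl c (c ^ l) (x₀ μ) _ _ ⟩
        c * (c ^ l * x₀ μ + power-sum l μ xs) + power-sum l μ ys
          ≈⟨ +-cong (*-congˡ (solves l (ℕ.m<n⇒m<1+n lt) μ)) (ys-solves l lt μ) ⟩
        c * b l μ + (b (suc l) μ - c * b l μ) ≈⟨ solve 2 (λ x y → x :+ (y :- x) := y) refl _ _ ⟩
        b (suc l) μ ∎
        where open IC

  sumL-concat-0 : ∀ {X : Set} {h : X → Carrier} W (f : Fin W → List X) → (∀ g → sumL h (f g) ≈ 0#) →
    sumL h (List.concat (List.tabulate f)) ≈ 0#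
  sumL-concat-0 zero f _ = refl
  sumL-concat-0 (suc W) f z = trans (sumL-++ (f zero) _) (trans (+-cong (z zero) (sumL-concat-0 W (f ∘ suc) (z ∘ suc))) (+-identityˡ 0#))

  sumL-concat-single : ∀ {X : Set} {h : X → Carrier} W (f : Fin W → List X) g₀ → (∀ g → g ≢ g₀ → sumL h (f g) ≈ 0#) →
    sumL h (List.concat (List.tabulate f)) ≈ sumL h (f g₀)
  sumL-concat-single (suc W) f zero z = trans (sumL-++ (f zero) _)
    (trans (+-congˡ (sumL-concat-0 W (f ∘ suc) (λ g → z (suc g) (λ ())))) (+-identityʳ _))
  sumL-concat-single (suc W) f (suc g₀) z = trans (sumL-++ (f zero) _)
    (trans (+-cong (z zero (λ ())) (sumL-concat-single W (f ∘ suc) g₀ (λ g ne → z (suc g) (ne ∘ Fin.suc-injective)))) (+-identityˡ _))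

  -- The points of PG(m-1, q), normalised so that the first nonzero coordinate is 1.
  simplexPoint : ∀ m → Fin (simplexCount N m) → Fin m → Carrier
  simplexPoint (suc m) s = [ (λ b → 1# Vector.∷ to ∘ finToFun b) , (λ s → 0# Vector.∷ simplexPoint m s) ]′ (splitAt (N ℕ.^ m) s)

  -- Scaling by the first nonzero coordinate normalises `d`. So one simplex column repairs a block,
  -- and a zero block costs no column at all.
  simplexPoint-surjective : ∀ m (d : Fin m → Carrier) → (∀ μ → d μ ≈ 0#) ⊎
    Σ Carrier λ c → Σ (Fin (simplexCount N m)) λ s → ∀ μ → c * simplexPoint m s μ ≈ d μ
  simplexPoint-surjective zero d = inj₁ λ ()
  simplexPoint-surjective (suc m) d with d zero ≟ 0#
  ... | no ne = inj₂ (d zero , b ↑ˡ _ , proof)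
    where
    b = funToFin (λ μ → from (inv (d zero) * d (suc μ)))
    proof : ∀ μ → d zero * simplexPoint (suc m) (b ↑ˡ simplexCount N m) μ ≈ d μ
    proof μ rewrite Fin.splitAt-↑ˡ (N ℕ.^ m) b (simplexCount N m) = values μ
      where
      values : ∀ μ → d zero * (1# Vector.∷ to ∘ finToFun b) μ ≈ d μ
      values zero = *-identityʳ _
      values (suc μ) = begin
        d zero * to (finToFun b μ) ≡⟨ ≡.cong (λ x → d zero * to x) (Fin.finToFun-funToFin _ μ) ⟩
        d zero * to (from (inv (d zero) * d (suc μ))) ≈⟨ *-congˡ (to-from _) ⟩
        d zero * (inv (d zero) * d (suc μ)) ≈⟨ *-assoc _ _ _ ⟨
        d zero * inv (d zero) * d (suc μ) ≈⟨ *-congʳ (inv-inverse ne) ⟩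
        1# * d (suc μ) ≈⟨ *-identityˡ _ ⟩
        d (suc μ) ∎
  ... | yes e with simplexPoint-surjective m (d ∘ suc)
  ... | inj₁ z = inj₁ λ { zero → e ; (suc μ) → z μ }
  ... | inj₂ (c , s , cs) = inj₂ (c , N ℕ.^ m ↑ʳ s , proof)
    where
    proof : ∀ μ → c * simplexPoint (suc m) (N ℕ.^ m ↑ʳ s) μ ≈ d μ
    proof μ rewrite Fin.splitAt-↑ʳ (N ℕ.^ m) (simplexCount N m) s = values μ
      where
      values : ∀ μ → c * (0# Vector.∷ simplexPoint m s) μ ≈ d μ
      values zero = trans (zeroʳ c) (sym e)
      values (suc μ) = cs μ

-- The parity-check matrix and its covering radius

module Construction (F : Field) (p j k r : ℕ) (p-prime : Prime p) (q′≡p^j : suc (suc k) ≡ p ℕ.^ j)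
                    (enum : HasSize F (suc (suc k) ℕ.^ suc (suc (suc (suc r)))))
                    (γ : ℕ) (2≤γ : 2 ≤ γ) (γ≤ : γ ≤ 3 ℕ.+ r) (m : ℕ) where
  open Representations F p j k (suc (suc (suc r))) p-prime q′≡p^j enum
  open Vandermonde F enum

  -- `W = R - 3` is the number of simplex blocks, called `w` in the theorem; here `w` is the weight
  -- bound `γ + 1`.
  q n w W columns : ℕ
  q = q′ ℕ.^ R
  n = R ℕ.+ γ
  w = suc γ
  W = suc r
  columns = pointCount Q n w ℕ.* q ℕ.^ m ℕ.+ W ℕ.* simplexCount q m

  Row : Set
  Row = Fin n ⊎ (Fin R × Fin m)

  Block : Set
  Block = (Pt n w × (Fin m → Carrier)) ⊎ (Fin W × (Fin m → Carrier))

  private abstract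
    fits : n ℕ.+ n ≤ q
    fits = colours-fit k r γ γ≤

  indicator : Pt n w → Carrier
  indicator v = to (inject≤ (join n n (colour v)) fits)

  indicator-injective : ∀ {u v} → colour u ≢ colour v → indicator u ≉ indicator v
  indicator-injective {u} {v} ne e = ne (≡.trans (≡.sym (Fin.splitAt-join n n (colour u)))
    (≡.trans (≡.cong (splitAt n) (Fin.inject≤-injective fits fits _ _
      (≡.trans (≡.sym (from-to _)) (≡.trans (from-cong e) (from-to _))))) (Fin.splitAt-join n n (colour v))))

  -- The Kronecker symbol of `l = g + 3`, read off from the entries of a unit point.
  δ : Fin W → Fin R → Carrier
  δ g (suc (suc (suc l))) = entry (unit {w = 0} g) l
  δ g _ = 0#

  -- The columns (v, ξ, βξ, …, β^{R-1}ξ) with β the indicator of v, and copies of the simplex columns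
  -- in all of the R blocks of m rows but the first three.
  matrix : Row → Block → Carrier
  matrix (inj₁ h) (inj₁ (v , ξ)) = entry v h
  matrix (inj₂ (l , μ)) (inj₁ (v , ξ)) = indicator v ^ toℕ l * ξ μ
  matrix (inj₁ h) (inj₂ _) = 0#
  matrix (inj₂ (l , μ)) (inj₂ (g , ξ)) = δ g l * ξ μ

  block : Fin columns → Block
  block i = [ (λ x → let (a , b) = remQuot {pointCount Q n w} (q ℕ.^ m) x in inj₁ (decodePoint n w a , to ∘ finToFun b))
            , (λ y → let (g , s) = remQuot {W} (simplexCount q m) y in inj₂ (g , simplexPoint m s)) ]′
            (splitAt (pointCount Q n w ℕ.* q ℕ.^ m) i)

  M : Row → Fin columns → Carrier
  M y i = matrix y (block i)

  pointColumn : Pt n w → (Fin m → Carrier) → Fin columns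
  pointColumn v ξ = combine (encodePoint v) (funToFin (from ∘ ξ)) ↑ˡ (W ℕ.* simplexCount q m)

  simplexColumn : Fin W → Fin (simplexCount q m) → Fin columns
  simplexColumn g s = (pointCount Q n w ℕ.* q ℕ.^ m) ↑ʳ combine g s

  block-point : ∀ v ξ → block (pointColumn v ξ) ≡ inj₁ (v , to ∘ finToFun (funToFin (from ∘ ξ)))
  block-point v ξ rewrite Fin.splitAt-↑ˡ (pointCount Q n w ℕ.* q ℕ.^ m) (combine (encodePoint v) (funToFin (from ∘ ξ))) (W ℕ.* simplexCount q m) =
    ≡.trans (≡.cong (λ u → inj₁ (decodePoint n w (proj₁ u) , to ∘ finToFun (proj₂ u))) (Fin.remQuot-combine (encodePoint v) _))
      (≡.cong (λ u → inj₁ (u , _)) (decode-encode v))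

  block-simplex : ∀ g s → block (simplexColumn g s) ≡ inj₂ (g , simplexPoint m s)
  block-simplex g s rewrite Fin.splitAt-↑ʳ (pointCount Q n w ℕ.* q ℕ.^ m) (W ℕ.* simplexCount q m) (combine g s) =
    ≡.cong (λ u → inj₂ (proj₁ u , simplexPoint m (proj₂ u))) (Fin.remQuot-combine g s)

  M-point : ∀ v ξ y → M y (pointColumn v ξ) ≈ matrix y (inj₁ (v , ξ))
  M-point v ξ y = trans (reflexive (≡.cong (matrix y) (block-point v ξ))) (decoded y)
    where
    decoded : ∀ y → matrix y (inj₁ (v , to ∘ finToFun (funToFin (from ∘ ξ)))) ≈ matrix y (inj₁ (v , ξ))
    decoded (inj₁ h) = refl
    decoded (inj₂ (l , μ)) = *-congˡ (trans (reflexive (≡.cong to (Fin.finToFun-funToFin (from ∘ ξ) μ))) (to-from _))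

  combine-columns : Row → List (Carrier × Fin columns) → Carrier
  combine-columns y = sumL (λ t → proj₁ t * M y (proj₂ t))

  simplex-block : ∀ g (d : Fin m → Carrier) → Σ (List (Carrier × Fin columns)) λ T →
    (length T ≤ 1) × (∀ y → combine-columns y T ≈ matrix y (inj₂ (g , d)))
  simplex-block g d = by-cases (simplexPoint-surjective m d)
    where
    by-cases : (∀ μ → d μ ≈ 0#) ⊎ (Σ Carrier λ c → Σ (Fin (simplexCount q m)) λ s → ∀ μ → c * simplexPoint m s μ ≈ d μ) →
      Σ (List (Carrier × Fin columns)) λ T → (length T ≤ 1) × (∀ y → combine-columns y T ≈ matrix y (inj₂ (g , d)))
    by-cases (inj₁ z) = [] , z≤n , λ { (inj₁ h) → refl ; (inj₂ (l , μ)) → sym (trans (*-congˡ (z μ)) (zeroʳ _)) }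
    by-cases (inj₂ (c , s , cs)) = (c , simplexColumn g s) ∷ [] , s≤s z≤n , λ y → trans (+-identityʳ _)
      (trans (*-congˡ (reflexive (≡.cong (matrix y) (block-simplex g s)))) (value y))
      where
      value : ∀ y → c * matrix y (inj₂ (g , simplexPoint m s)) ≈ matrix y (inj₂ (g , d))
      value (inj₁ h) = zeroʳ c
      value (inj₂ (l , μ)) = trans (solve 3 (λ c e x → c :* (e :* x) := e :* (c :* x)) refl c (δ g l) (simplexPoint m s μ)) (*-congˡ (cs μ))
        where open IC

  -- `K` is here the number of blocks already fitted, not the subfield. As `K ≥ 3`, these include
  -- the blocks without simplex columns, and each of the other `R - K` blocks takes at most one.
  simplex-blocks : ∀ K → 3 ≤ K → (d : Fin R → Fin m → Carrier) → (∀ l μ → toℕ l < K → d l μ ≈ 0#) →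
    Σ (List (Carrier × Fin columns)) λ T → (length T ≤ R ∸ K) ×
      (∀ h → combine-columns (inj₁ h) T ≈ 0#) × (∀ l μ → combine-columns (inj₂ (l , μ)) T ≈ d l μ)
  simplex-blocks (suc (suc (suc K))) (s≤s (s≤s (s≤s _))) d d≈0 = List.concat (List.tabulate f) , length-concat W f K f-length f-small ,
    (λ h → sumL-concat-0 W f (λ g → f-top g h)) , λ
      { zero μ → trans (sumL-concat-0 W f (λ g → f-low g zero μ (λ _ → refl))) (sym (d≈0 zero μ (s≤s z≤n)))
      ; (suc zero) μ → trans (sumL-concat-0 W f (λ g → f-low g (suc zero) μ (λ _ → refl))) (sym (d≈0 (suc zero) μ (s≤s (s≤s z≤n))))
      ; (suc (suc zero)) μ → trans (sumL-concat-0 W f (λ g → f-low g (suc (suc zero)) μ (λ _ → refl))) (sym (d≈0 (suc (suc zero)) μ (s≤s (s≤s (s≤s z≤n)))))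
      ; (suc (suc (suc l))) μ → trans (sumL-concat-single W f l (λ g ne → f-value-0 g l μ ne)) (f-value l μ) }
    where
    d′ : Fin W → Fin m → Carrier
    d′ g = d (suc (suc (suc g)))
    choose : ∀ g → Dec (toℕ g < K) → List (Carrier × Fin columns)
    choose g (yes _) = []
    choose g (no _) = proj₁ (simplex-block g (d′ g))
    f : Fin W → List (Carrier × Fin columns)
    f g = choose g (toℕ g ℕ.<? K)
    f-length : ∀ g → length (f g) ≤ 1
    f-length g with toℕ g ℕ.<? K
    ... | yes _ = z≤n
    ... | no _ = proj₁ (proj₂ (simplex-block g (d′ g)))
    f-small : ∀ g → toℕ g < K → f g ≡ []
    f-small g g<K with toℕ g ℕ.<? K
    ... | yes _ = ≡.refl
    ... | no g≮K = contradiction g<K g≮K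
    f-top : ∀ g h → combine-columns (inj₁ h) (f g) ≈ 0#
    f-top g h with toℕ g ℕ.<? K
    ... | yes _ = refl
    ... | no _ = proj₂ (proj₂ (simplex-block g (d′ g))) (inj₁ h)
    f-low : ∀ g l μ → (∀ g → δ g l ≈ 0#) → combine-columns (inj₂ (l , μ)) (f g) ≈ 0#
    f-low g l μ z with toℕ g ℕ.<? K
    ... | yes _ = refl
    ... | no _ = trans (proj₂ (proj₂ (simplex-block g (d′ g))) (inj₂ (l , μ))) (trans (*-congʳ (z g)) (zeroˡ _))
    f-value-0 : ∀ g l μ → g ≢ l → combine-columns (inj₂ (suc (suc (suc l)) , μ)) (f g) ≈ 0#
    f-value-0 g l μ ne with toℕ g ℕ.<? K
    ... | yes _ = refl
    ... | no _ = trans (proj₂ (proj₂ (simplex-block g (d′ g))) (inj₂ (suc (suc (suc l)) , μ))) (trans (*-congʳ (unit-≢ {w = 0} ne)) (zeroˡ _))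
    f-value : ∀ l μ → combine-columns (inj₂ (suc (suc (suc l)) , μ)) (f l) ≈ d (suc (suc (suc l))) μ
    f-value l μ with toℕ l ℕ.<? K
    ... | yes l<K = sym (d≈0 (suc (suc (suc l))) μ (s≤s (s≤s (s≤s l<K))))
    ... | no _ = trans (proj₂ (proj₂ (simplex-block l (d′ l))) (inj₂ (suc (suc (suc l)) , μ)))
                   (trans (*-congʳ (unit-≡ {w = 0} l)) (*-identityˡ _))

  covered : (s : Row → Carrier) → Σ (List (Carrier × Fin columns)) λ T → (length T ≤ R) × (∀ y → s y ≈ combine-columns y T)
  covered s = T₁ ++ T₂ , bound , λ y → sym (trans (sumL-++ T₁ T₂) (total y))
    where
    4≤R : 4 ≤ R
    4≤R = s≤s (s≤s (s≤s (s≤s z≤n)))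
    n≥3 : 3 ≤ n
    n≥3 = s≤s (s≤s (s≤s z≤n))
    3≤q : 3 ≤ q
    3≤q = ℕ.≤-trans n≥3 (ℕ.≤-trans (ℕ.m≤m+n n n) fits)
    module Rep = Representation (represent {n} {w} 4≤R 3≤q (s≤s (ℕ.≤-reflexive (ℕ.+-comm R γ))) n≥3 (s≤s 2≤γ) (s ∘ inj₁))
    κ# = length Rep.terms
    A = Carrier × Pt n w
    β : A → Carrier
    β = indicator ∘ proj₂
    -- `vandermonde` expects a right-hand side indexed by all of `ℕ`. The zeros from `R` on are
    -- padding, beyond the equations that are used.
    extended : ∀ l → Dec (l < R) → Fin m → Carrier
    extended l (yes l<R) μ = s (inj₂ (fromℕ< l<R , μ))
    extended l (no _) μ = 0#
    rhs : ℕ → Fin m → Carrier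
    rhs l = extended l (l ℕ.<? R)
    rhs-toℕ : ∀ (l : Fin R) μ → rhs (toℕ l) μ ≈ s (inj₂ (l , μ))
    rhs-toℕ l μ with toℕ l ℕ.<? R
    ... | yes l<R = reflexive (≡.cong (λ x → s (inj₂ (x , μ))) (Fin.fromℕ<-toℕ l l<R))
    ... | no l≮R = contradiction (Fin.toℕ<n l) l≮R
    solution = vandermonde β Rep.terms (AllPairs.map (λ {s} {t} → indicator-injective {proj₂ s} {proj₂ t}) Rep.distinct) rhs
    xs = proj₁ solution
    xs-terms = proj₁ (proj₂ solution)
    xs-nonzero : All (λ x → proj₁ (proj₁ x) ≉ 0#) xs
    xs-nonzero = All.map⁻ (≡.subst (All (λ t → proj₁ t ≉ 0#)) (≡.sym xs-terms) Rep.nonzero)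
    -- The unknown `x` of the linear system is `c ξ`. Since the coefficient `c` is already fixed by
    -- the top rows, `ξ` is recovered by dividing by `c`, which is why representations require
    -- nonzero coefficients.
    column : A × (Fin m → Carrier) → Carrier × Fin columns
    column ((c , v) , x) = c , pointColumn v (λ μ → inv c * x μ)
    T₁ = List.map column xs
    T₁-length : length T₁ ≡ κ#
    T₁-length = ≡.trans (List.length-map column xs) (≡.trans (≡.sym (List.length-map proj₁ xs)) (≡.cong length xs-terms))
    T₁-top : ∀ h → combine-columns (inj₁ h) T₁ ≈ s (inj₁ h)
    T₁-top h = begin
      combine-columns (inj₁ h) T₁ ≡⟨ sumL-map column xs ⟩
      sumL (λ z → proj₁ (column z) * M (inj₁ h) (proj₂ (column z))) xs
        ≈⟨ sumL-cong xs (λ {z} _ → *-congˡ (M-point (proj₂ (proj₁ z)) (λ μ → inv (proj₁ (proj₁ z)) * proj₂ z μ) (inj₁ h))) ⟩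
      sumL (λ z → proj₁ (proj₁ z) * entry (proj₂ (proj₁ z)) h) xs ≡⟨ sumL-map {f = λ t → proj₁ t * entry (proj₂ t) h} proj₁ xs ⟨
      sumL (λ t → proj₁ t * entry (proj₂ t) h) (List.map proj₁ xs) ≡⟨ ≡.cong (sumL (λ t → proj₁ t * entry (proj₂ t) h)) xs-terms ⟩
      sumL (λ t → proj₁ t * entry (proj₂ t) h) Rep.terms ≈⟨ Rep.represents h ⟨
      s (inj₁ h) ∎
    T₁-block : ∀ l μ → combine-columns (inj₂ (l , μ)) T₁ ≈ power-sum β (toℕ l) μ xs
    T₁-block l μ = trans (reflexive (sumL-map column xs)) (sumL-cong xs value)
      where
      value : ∀ {z} → z ∈ xs → proj₁ (column z) * M (inj₂ (l , μ)) (proj₂ (column z)) ≈ β (proj₁ z) ^ toℕ l * proj₂ z μ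
      value {(c , v) , x} z∈ = begin
        c * M (inj₂ (l , μ)) (pointColumn v (λ μ → inv c * x μ)) ≈⟨ *-congˡ (M-point v (λ μ → inv c * x μ) (inj₂ (l , μ))) ⟩
        c * (indicator v ^ toℕ l * (inv c * x μ))
          ≈⟨ solve 4 (λ c b i x → c :* (b :* (i :* x)) := (c :* i) :* (b :* x)) refl c _ (inv c) (x μ) ⟩
        (c * inv c) * (indicator v ^ toℕ l * x μ) ≈⟨ *-congʳ (inv-inverse (All.lookup xs-nonzero z∈)) ⟩
        1# * (indicator v ^ toℕ l * x μ) ≈⟨ *-identityˡ _ ⟩
        indicator v ^ toℕ l * x μ ∎
        where open IC
    residue : Fin R → Fin m → Carrier
    residue l μ = s (inj₂ (l , μ)) - power-sum β (toℕ l) μ xs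
    residue-0 : ∀ l μ → toℕ l < κ# → residue l μ ≈ 0#
    residue-0 l μ l<κ = x≈y⇒x-y≈0 (trans (sym (rhs-toℕ l μ)) (sym (proj₂ (proj₂ solution) (toℕ l) l<κ μ)))
    correction = simplex-blocks κ# Rep.length≥3 residue residue-0
    T₂ = proj₁ correction
    bound : length (T₁ ++ T₂) ≤ R
    bound = ≡.subst₂ _≤_ (≡.sym (≡.trans (List.length-++ T₁) (≡.cong (ℕ._+ length T₂) T₁-length))) (ℕ.m+[n∸m]≡n Rep.length≤R)
      (ℕ.+-monoʳ-≤ κ# (proj₁ (proj₂ correction)))
    total : ∀ y → combine-columns y T₁ + combine-columns y T₂ ≈ s y
    total (inj₁ h) = trans (+-cong (T₁-top h) (proj₁ (proj₂ (proj₂ correction)) h)) (+-identityʳ _)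
    total (inj₂ (l , μ)) = trans (+-cong (T₁-block l μ) (proj₂ (proj₂ (proj₂ correction)) l μ))
      (solve 2 (λ a b → a :+ (b :- a) := b) refl _ _)
      where open IC

  M-top-K : ∀ h i → K (M (inj₁ h) i)
  M-top-K h i = matrix-K (block i)
    where
    matrix-K : ∀ b → K (matrix (inj₁ h) b)
    matrix-K (inj₁ (v , _)) = entry-K v h
    matrix-K (inj₂ _) = K-0

  nth : ∀ {N} → List Carrier → Fin N → Carrier
  nth [] _ = 0#
  nth (x ∷ xs) zero = x
  nth (x ∷ xs) (suc i) = nth xs i

  all-nth : ∀ {N} {P : Carrier → Set} xs → length xs ≤ N → (∀ (h : Fin N) → P (nth xs h)) → All P xs
  all-nth [] _ _ = []
  all-nth {suc N} (x ∷ xs) (s≤s le) ps = ps zero ∷ all-nth xs le (ps ∘ suc)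

  -- The roles are exchanged: the multipliers `c i` in `F` become the spanning elements, and the
  -- matrix entries, lying in `K`, become the scalars.
  span-∑ : ∀ l (c x : Fin l → Carrier) → (∀ i → K (x i)) → Span (List.tabulate c) (∑ F l (λ i → c i * x i))
  span-∑ zero c x kx = nil refl
  span-∑ (suc l) c x kx = cons (kx zero) (span-∑ l (c ∘ suc) (x ∘ suc) (kx ∘ suc)) (+-congʳ (*-comm _ _))

  hard : Σ (Row → Carrier) λ s → ∀ l (idx : Fin l → Fin columns) (c : Fin l → Carrier) →
    (∀ y → s y ≈ ∑ F l (λ i → c i * M y (idx i))) → R ≤ l
  hard = s , λ l idx c e → ≡.subst (R ≤_) (List.length-tabulate c) (spanning-length λ y →
      span-trans (xs-span y) (all-nth xs xs-length λ h → span-resp (sym (e (inj₁ h))) (span-∑ l c _ (λ i → M-top-K h (idx i)))))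
    where
    -- Applied to the enumeration of all elements, the greedy choice yields a `K`-basis of `F`. It
    -- has at most `R` members and fits into the `n` top rows, padded with zeros.
    module B = Basis (basis to)
    xs = List.map to B.I
    xs-span : ∀ y → Span xs y
    xs-span y = span-resp (to-from y) (B.span (from y))
    xs-length : length xs ≤ n
    xs-length = ℕ.≤-trans (≡.subst (_≤ R) (≡.sym (List.length-map to B.I)) B.length≤R) (ℕ.m≤m+n R γ)
    s : Row → Carrier
    s = [ nth xs , (λ _ → 0#) ]′

  parityCheck : ∀ {rows cols} → (Fin rows → Row) → cols ≡ columns → Fin rows → Fin cols → Carrier
  parityCheck ρ cols≡ i c = M (ρ i) (Fin.cast cols≡ c)

  coveringRadius : ∀ {rows cols} (ρ : Fin rows → Row) (ρ⁻¹ : Row → Fin rows) → (∀ i → ρ⁻¹ (ρ i) ≡ i) → (∀ y → ρ (ρ⁻¹ y) ≡ y) →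
    (cols≡ : cols ≡ columns) → HasCoveringRadius F (parityCheck ρ cols≡) R
  coveringRadius {rows} {cols} ρ ρ⁻¹ ρ⁻¹ρ ρρ⁻¹ ≡.refl = upper , lower
    where
    ∑-lookup : ∀ {A : Set} (g : A → Carrier) xs → sumL g xs ≈ ∑ F (length xs) (λ i → g (List.lookup xs i))
    ∑-lookup g [] = refl
    ∑-lookup g (x ∷ xs) = +-congˡ (∑-lookup g xs)
    ∑-cong : ∀ l {f g : Fin l → Carrier} → (∀ i → f i ≈ g i) → ∑ F l f ≈ ∑ F l g
    ∑-cong zero e = refl
    ∑-cong (suc l) e = +-cong (e zero) (∑-cong l (e ∘ suc))
    cast-id : ∀ y (i : Fin columns) → M y (Fin.cast ≡.refl i) ≈ M y i
    cast-id y i = reflexive (≡.cong (M y) (Fin.cast-is-id ≡.refl i))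
    upper : CoveredWithin F (parityCheck ρ ≡.refl) R
    upper s = let T , le , e = covered (s ∘ ρ⁻¹) in
      length T , le , proj₂ ∘ List.lookup T , proj₁ ∘ List.lookup T , λ i → begin
        s i ≡⟨ ≡.cong s (ρ⁻¹ρ i) ⟨
        s (ρ⁻¹ (ρ i)) ≈⟨ e (ρ i) ⟩
        combine-columns (ρ i) T ≈⟨ ∑-lookup _ T ⟩
        ∑ F (length T) (λ a → proj₁ (List.lookup T a) * M (ρ i) (proj₂ (List.lookup T a)))
          ≈⟨ ∑-cong (length T) (λ a → *-congˡ (cast-id (ρ i) (proj₂ (List.lookup T a)))) ⟨
        ∑ F (length T) (λ a → proj₁ (List.lookup T a) * M (ρ i) (Fin.cast ≡.refl (proj₂ (List.lookup T a)))) ∎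
    lower : ∀ l → CoveredWithin F (parityCheck ρ ≡.refl) l → R ≤ l
    lower l cov = let a , a≤l , idx , c , e = cov (proj₁ hard ∘ ρ) in
      ℕ.≤-trans (proj₂ hard a idx c λ y → begin
        proj₁ hard y ≡⟨ ≡.cong (proj₁ hard) (ρρ⁻¹ y) ⟨
        proj₁ hard (ρ (ρ⁻¹ y)) ≈⟨ e (ρ⁻¹ y) ⟩
        ∑ F a (λ i → c i * M (ρ (ρ⁻¹ y)) (Fin.cast ≡.refl (idx i)))
          ≈⟨ ∑-cong a (λ i → *-congˡ (trans (cast-id (ρ (ρ⁻¹ y)) (idx i)) (reflexive (≡.cong (λ z → M z (idx i)) (ρρ⁻¹ y))))) ⟩
        ∑ F a (λ i → c i * M y (idx i)) ∎) a≤l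

-- Matching the dimensions in the theorem

open import Data.Nat using (_+_; _*_; _^_)

abstract
 codimension-split : ∀ R m γ → R * suc m + γ ≡ (R + γ) + R * m
 codimension-split = ℕ-solve-∀

rowIndex : ∀ R m γ → Σ (Fin (R * suc m + γ) → Fin (R + γ) ⊎ (Fin R × Fin m)) λ ρ →
  Σ (Fin (R + γ) ⊎ (Fin R × Fin m) → Fin (R * suc m + γ)) λ ρ⁻¹ →
  (∀ i → ρ⁻¹ (ρ i) ≡ i) × (∀ y → ρ (ρ⁻¹ y) ≡ y)
rowIndex R m γ rewrite codimension-split R m γ =
    Sum.map id (remQuot m) ∘ splitAt (R + γ)
  , join (R + γ) (R * m) ∘ Sum.map id (λ (l , μ) → combine l μ)
  , (λ i → ≡.trans (≡.cong (join (R + γ) (R * m)) (merge (splitAt (R + γ) i))) (Fin.join-splitAt (R + γ) (R * m) i))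
  , λ y → ≡.trans (≡.cong (Sum.map id (remQuot m)) (Fin.splitAt-join (R + γ) (R * m) (Sum.map id (λ (l , μ) → combine l μ) y))) (split y)
  where
  merge : ∀ z → Sum.map id (λ (l , μ) → combine l μ) (Sum.map id (remQuot {R} m) z) ≡ z
  merge (inj₁ _) = ≡.refl
  merge (inj₂ z) = ≡.cong inj₂ (Fin.combine-remQuot {R} m z)
  split : ∀ y → Sum.map id (remQuot {R} m) (Sum.map id (λ (l , μ) → combine l μ) y) ≡ y
  split (inj₁ _) = ≡.refl
  split (inj₂ (l , μ)) = ≡.cong inj₂ (Fin.remQuot-combine l μ)

primePower≥2 : ∀ {q'} → IsPrimePower q' → 2 ≤ q'
primePower≥2 (p , e , pr , ≡.refl) = ℕ.≤-trans (ℕ.nonTrivial⇒n>1 p) (ℕ.m≤m*n p (p ^ e))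
  where instance
          _ = prime⇒nonTrivial pr
          _ = ℕ.nonTrivial⇒nonZero p
          _ = ℕ.m^n≢0 p e

nGamma>1 : ∀ R k γ → 2 ≤ γ → 1 < nGamma (suc (suc R)) (suc (suc k)) γ
nGamma>1 R k (suc γ) _ rewrite nGamma-count (suc (suc R)) k (suc γ) = s≤s (s≤s z≤n)

theorem23 : (R q' γ : ℕ) → 4 ≤ R → IsPrimePower q' →
    2 ≤ γ → γ ≤ R ∸ 1 →
    (t₀ : ℕ) → nGamma R q' γ ≤ (q' ^ R) ^ (t₀ ∸ 1) →
    (t : ℕ) → (t ≡ 1 ⊎ t₀ ≤ t) →
    (F : Field) → HasSize F (q' ^ R) →
    Σ ℕ λ w → (w ≤ R ∸ 3) ×
    Σ (Fin (R * t + γ) → Fin (nGamma R q' γ * (q' ^ R) ^ (t ∸ 1) + w * (((q' ^ R) ^ (t ∸ 1) ∸ 1) div (q' ^ R ∸ 1))) → Field.Carrier F) λ H →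
    HasCoveringRadius F H R
theorem23 R q' γ 4≤R pp 2≤γ γ≤ t₀ bound t t-cond F enum = by-cases R q' 4≤R pp (primePower≥2 pp) γ≤ bound t t-cond enum
  where
  by-cases : ∀ R q' → 4 ≤ R → IsPrimePower q' → 2 ≤ q' → γ ≤ R ∸ 1 → nGamma R q' γ ≤ (q' ^ R) ^ (t₀ ∸ 1) →
    ∀ t → (t ≡ 1 ⊎ t₀ ≤ t) → HasSize F (q' ^ R) →
    Σ ℕ λ w → (w ≤ R ∸ 3) ×
    Σ (Fin (R * t + γ) → Fin (nGamma R q' γ * (q' ^ R) ^ (t ∸ 1) + w * (((q' ^ R) ^ (t ∸ 1) ∸ 1) div (q' ^ R ∸ 1))) → Field.Carrier F) λ H →
    HasCoveringRadius F H R
  -- Here `t = t₀ = 0`. Truncated subtraction turns the bound into `nGamma R q' γ ≤ 1`, which is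
  -- false.
  by-cases R@(suc (suc (suc (suc r)))) q'@(suc (suc k)) (s≤s (s≤s (s≤s (s≤s _)))) _ (s≤s (s≤s _)) _ bound zero (inj₂ z≤n) _ =
    contradiction bound (ℕ.<⇒≱ (nGamma>1 (suc (suc r)) k γ 2≤γ))
  by-cases R@(suc (suc (suc (suc r)))) q'@(suc (suc k)) (s≤s (s≤s (s≤s (s≤s _)))) (p , j , pr , q'≡) (s≤s (s≤s _)) γ≤ bound (suc m) _ enum =
    -- The witness for `w` is `R - 3`: one simplex block for each lower block after the third.
    suc r , ℕ.≤-refl , C.parityCheck ρ columns≡ , C.coveringRadius ρ ρ⁻¹ ρ⁻¹ρ ρρ⁻¹ columns≡
    where
    module C = Construction F p (suc j) k r pr q'≡ enum γ 2≤γ γ≤ m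
    rowInverse = rowIndex R m γ
    ρ = proj₁ rowInverse
    ρ⁻¹ = proj₁ (proj₂ rowInverse)
    ρ⁻¹ρ = proj₁ (proj₂ (proj₂ rowInverse))
    ρρ⁻¹ = proj₂ (proj₂ (proj₂ rowInverse))
    2≤q : 2 ≤ q' ^ R
    2≤q = ℕ.≤-trans (s≤s (s≤s z≤n)) (ℕ.m≤m*n q' (q' ^ suc (suc (suc r))) {{ℕ.m^n≢0 q' (suc (suc (suc r)))}})
    columns≡ : nGamma R q' γ * (q' ^ R) ^ m + suc r * (((q' ^ R) ^ m ∸ 1) div (q' ^ R ∸ 1)) ≡ C.columns
    columns≡ = ≡.cong₂ (λ a b → a * (q' ^ R) ^ m + suc r * b) (nGamma-count R k γ) (simplexCount-div (q' ^ R) 2≤q m)
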